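{- For all $n\ge 2$ and $0\le k\le n-2$, $$f(n,k)=\sum_{j=0}^{k}\binom{k-j}{j}(-1)^j\,(n-2-j)!.$$
   Context: A complete non-ambiguous matrix (CNM) of size $n$ is an $n\times n$ matrix $M=(m_{i,j})$ with entries in $\{0,1\}$ whose support $T=\{(i,j): m_{i,j}=1\}$ (whose elements are called vertices) satisfies: (1) $(1,1)\in T$; (2) for every $p=(i,j)\in T$ with $p\neq(1,1)$, exactly one of the following holds: there is $(i',j)\in T$ with $i'<i$, or there is $(i,j')\in T$ with $j'<j$; (3) every row and every column of $M$ contains at least one vertex; (4) define the parent of $p=(i,j)\neq(1,1)$ to be $(i',j)$ with $i'<i$ maximal if such a vertex exists, and otherwise $(i,j')$ with $j'<j$ maximal; then every vertex is the parent of either zero or exactly two vertices. A vertex with no children is a leaf. A CNM of size $n$ is upper-diagonal if its leaves are exactly the positions $(i,n+1-i)$, $1\le i\le n$. For $n\ge 2$ and $0\le k\le n-2$, $f(n,k)$ is the number of upper-diagonal CNMs $M$ of size $n$ with $m_{i,n-i}=0$ for $1\le i\le k$ and $m_{k+1,n-k-1}=1$. Binomial coefficients $\binom{a}{b}$ with $b>a\ge 0$ are $0$. -}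

module Defs where

open import Data.Bool using (Bool; true; false)
open import Data.Bool.Properties using () renaming (_≟_ to _≟ᵇ_)
open import Data.Fin using (Fin; toℕ; _<_; _≤_)
open import Data.Fin.Properties using (any?; all?; _<?_; _≤?_)
open import Data.Integer.Properties using (+-0-commutativeMonoid)
open import Data.List as List using (List; []; _∷_; length; filter; allFin; cartesianProduct; cartesianProductWith)
open import Data.List.Membership.Propositional using (_∈_)
open import Data.List.Membership.Propositional.Properties using (∈-cartesianProductWith⁺)
open import Data.List.Relation.Unary.All as All using ()
open import Data.List.Relation.Unary.AllPairs using ([]; _∷_)
open import Data.List.Relation.Unary.Any using (here; there)
open import Data.List.Relation.Unary.Unique.Propositional using (Unique)
import Data.List.Relation.Unary.Unique.Propositional.Properties as Unique
open import Data.Nat as ℕ using (ℕ; zero; suc; _+_)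
open import Data.Product using (_×_; _,_; ∃; proj₁; proj₂)
open import Data.Sum using (_⊎_)
open import Data.Vec as Vec using (Vec; []; _∷_; lookup)
open import Data.Vec.Properties using (∷-injective)
open import Relation.Binary.PropositionalEquality using (_≡_; refl)
open import Relation.Nullary using (¬_; Dec; ¬?; _×-dec_; _⊎-dec_; _→-dec_)
open import Relation.Nullary.Decidable using (map′)

-- Finite sums in ℤ:  ∑[ j ≤ k ] g j  runs over j : Fin (suc k), i.e. j = 0 , … , k.
open import Algebra.Properties.CommutativeMonoid.Sum +-0-commutativeMonoid public
  using (sum⁺-syntax)

Matrix : ℕ → Set
Matrix n = Vec (Vec Bool n) n

Position : ℕ → Set
Position n = Fin n × Fin n

-- Rows and columns are numbered from 1, so  idx i  is the usual index of i : Fin n.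
idx : ∀ {n} → Fin n → ℕ
idx i = suc (toℕ i)

entry : ∀ {n} → Matrix n → Position n → Bool
entry M (i , j) = lookup (lookup M i) j

IsRoot : ∀ {n} → Position n → Set
IsRoot (i , j) = idx i ≡ 1 × idx j ≡ 1

isRoot? : ∀ {n} (p : Position n) → Dec (IsRoot p)
isRoot? (i , j) = (idx i ℕ.≟ 1) ×-dec (idx j ℕ.≟ 1)

ExactlyOne : Set → Set → Set
ExactlyOne A B = (A × ¬ B) ⊎ (¬ A × B)

exactlyOne? : ∀ {A B} → Dec A → Dec B → Dec (ExactlyOne A B)
exactlyOne? a? b? = (a? ×-dec ¬? b?) ⊎-dec (¬? a? ×-dec b?)

module _ {n} (M : Matrix n) where

  Vertex : Position n → Set
  Vertex p = entry M p ≡ true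

  vertex? : ∀ p → Dec (Vertex p)
  vertex? p = entry M p ≟ᵇ true

  HasAbove HasLeft : Position n → Set
  HasAbove (i , j) = ∃ λ i′ → i′ < i × Vertex (i′ , j)
  HasLeft  (i , j) = ∃ λ j′ → j′ < j × Vertex (i , j′)

  hasAbove? : ∀ p → Dec (HasAbove p)
  hasAbove? (i , j) = any? λ i′ → (i′ <? i) ×-dec vertex? (i′ , j)

  hasLeft? : ∀ p → Dec (HasLeft p)
  hasLeft? (i , j) = any? λ j′ → (j′ <? j) ×-dec vertex? (i , j′)

  -- NearestAbove q p: q is the vertex (i′ , j) with i′ < i maximal, for p = (i , j);
  -- NearestLeft likewise within the row of p.
  NearestAbove NearestLeft : Position n → Position n → Set
  NearestAbove (i′ , j′) (i , j) =
    j′ ≡ j × i′ < i × Vertex (i′ , j) × (∀ i″ → i″ < i → Vertex (i″ , j) → i″ ≤ i′)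
  NearestLeft (i′ , j′) (i , j) =
    i′ ≡ i × j′ < j × Vertex (i , j′) × (∀ j″ → j″ < j → Vertex (i , j″) → j″ ≤ j′)

  nearestAbove? : ∀ q p → Dec (NearestAbove q p)
  nearestAbove? (i′ , j′) (i , j) =
    (j′ Data.Fin.≟ j) ×-dec (i′ <? i) ×-dec vertex? (i′ , j) ×-dec
    all? λ i″ → (i″ <? i) →-dec (vertex? (i″ , j) →-dec (i″ ≤? i′))

  nearestLeft? : ∀ q p → Dec (NearestLeft q p)
  nearestLeft? (i′ , j′) (i , j) =
    (i′ Data.Fin.≟ i) ×-dec (j′ <? j) ×-dec vertex? (i , j′) ×-dec
    all? λ j″ → (j″ <? j) →-dec (vertex? (i , j″) →-dec (j″ ≤? j′))

  -- Parent q p: q is the parent of p.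
  Parent : Position n → Position n → Set
  Parent q p =
    Vertex p × ¬ IsRoot p × (NearestAbove q p ⊎ (¬ HasAbove p × NearestLeft q p))

  parent? : ∀ q p → Dec (Parent q p)
  parent? q p =
    vertex? p ×-dec ¬? (isRoot? p) ×-dec
    (nearestAbove? q p ⊎-dec (¬? (hasAbove? p) ×-dec nearestLeft? q p))

  children : Position n → List (Position n)
  children q = filter (parent? q) (cartesianProduct (allFin n) (allFin n))

  Leaf : Position n → Set
  Leaf p = Vertex p × length (children p) ≡ 0

  leaf? : ∀ p → Dec (Leaf p)
  leaf? p = vertex? p ×-dec (length (children p) ℕ.≟ 0)

  record IsCNM : Set where
    field
      root        : ∃ λ p → IsRoot p × Vertex p
      aboveOrLeft : ∀ p → Vertex p → ¬ IsRoot p → ExactlyOne (HasAbove p) (HasLeft p)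
      rows        : ∀ i → ∃ λ j → Vertex (i , j)
      columns     : ∀ j → ∃ λ i → Vertex (i , j)
      complete    : ∀ p → Vertex p → length (children p) ≡ 0 ⊎ length (children p) ≡ 2

  -- The leaf condition says: (i , j) is a leaf iff j = n + 1 - i.
  record IsUpperDiagonalCNM : Set where
    field
      isCNM          : IsCNM
      leaf⇒diagonal  : ∀ i j → Leaf (i , j) → idx i + idx j ≡ n + 1
      diagonal⇒leaf  : ∀ i j → idx i + idx j ≡ n + 1 → Leaf (i , j)

  -- m_{i,n-i} = 0 for 1 ≤ i ≤ k, and m_{k+1,n-k-1} = 1.
  record FirstOneAfter (k : ℕ) : Set where
    field
      zeros : ∀ i j → idx i ℕ.≤ k → idx i + idx j ≡ n → entry M (i , j) ≡ false
      one   : ∃ λ i → ∃ λ j → idx i ≡ k + 1 × idx i + idx j ≡ n × entry M (i , j) ≡ true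

  private
    allPositions? : {P : Position n → Set} → (∀ p → Dec (P p)) → Dec (∀ p → P p)
    allPositions? P? = map′ (λ f (i , j) → f i j) (λ f i j → f (i , j))
      (all? λ i → all? λ j → P? (i , j))

    anyPosition? : {P : Position n → Set} → (∀ p → Dec (P p)) → Dec (∃ P)
    anyPosition? P? = map′ (λ (i , j , x) → (i , j) , x) (λ ((i , j) , x) → i , j , x)
      (any? λ i → any? λ j → P? (i , j))

  isCNM? : Dec IsCNM
  isCNM? = map′
    (λ (a , b , c , d , e) → record
      { root = a ; aboveOrLeft = b ; rows = c ; columns = d ; complete = e })
    (λ x → let open IsCNM x in root , aboveOrLeft , rows , columns , complete)
    (anyPosition? (λ p → isRoot? p ×-dec vertex? p) ×-dec
     allPositions? (λ p → vertex? p →-dec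
       (¬? (isRoot? p) →-dec exactlyOne? (hasAbove? p) (hasLeft? p))) ×-dec
     all? (λ i → any? λ j → vertex? (i , j)) ×-dec
     all? (λ j → any? λ i → vertex? (i , j)) ×-dec
     allPositions? (λ p → vertex? p →-dec
       ((length (children p) ℕ.≟ 0) ⊎-dec (length (children p) ℕ.≟ 2))))

  isUpperDiagonalCNM? : Dec IsUpperDiagonalCNM
  isUpperDiagonalCNM? = map′
    (λ (a , b , c) → record { isCNM = a ; leaf⇒diagonal = b ; diagonal⇒leaf = c })
    (λ x → let open IsUpperDiagonalCNM x in isCNM , leaf⇒diagonal , diagonal⇒leaf)
    (isCNM? ×-dec
     all? (λ i → all? λ j → leaf? (i , j) →-dec (idx i + idx j ℕ.≟ n + 1)) ×-dec
     all? (λ i → all? λ j → (idx i + idx j ℕ.≟ n + 1) →-dec leaf? (i , j)))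

  firstOneAfter? : ∀ k → Dec (FirstOneAfter k)
  firstOneAfter? k = map′
    (λ (a , b) → record { zeros = a ; one = b })
    (λ x → let open FirstOneAfter x in zeros , one)
    (all? (λ i → all? λ j → (idx i ℕ.≤? k) →-dec
       ((idx i + idx j ℕ.≟ n) →-dec (entry M (i , j) ≟ᵇ false))) ×-dec
     any? (λ i → any? λ j → (idx i ℕ.≟ k + 1) ×-dec
       (idx i + idx j ℕ.≟ n) ×-dec (entry M (i , j) ≟ᵇ true)))

allVecs : {A : Set} → List A → ∀ n → List (Vec A n)
allVecs xs zero    = [] ∷ []
allVecs xs (suc n) = cartesianProductWith _∷_ xs (allVecs xs n)

allMatrices : ∀ n → List (Matrix n)
allMatrices n = allVecs (allVecs (true ∷ false ∷ []) n) n

-- Filtering allMatrices counts correctly: every matrix occurs in it exactly once.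
allVecs-complete : {A : Set} {xs : List A} → (∀ x → x ∈ xs) →
                   ∀ {n} (v : Vec A n) → v ∈ allVecs xs n
allVecs-complete c []      = here refl
allVecs-complete c (x ∷ v) = ∈-cartesianProductWith⁺ _∷_ (c x) (allVecs-complete c v)

allVecs-unique : {A : Set} {xs : List A} → Unique xs → ∀ n → Unique (allVecs xs n)
allVecs-unique u zero    = All.[] ∷ []
allVecs-unique u (suc n) =
  Unique.cartesianProductWith⁺ _∷_ ∷-injective u (allVecs-unique u n)

allMatrices-complete : ∀ {n} (M : Matrix n) → M ∈ allMatrices n
allMatrices-complete = allVecs-complete (allVecs-complete λ where
  true  → here refl
  false → there (here refl))

allMatrices-unique : ∀ n → Unique (allMatrices n)
allMatrices-unique n = allVecs-unique
  (allVecs-unique (((λ ()) All.∷ All.[]) ∷ All.[] ∷ []) n) n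

f : ℕ → ℕ → ℕ
f n k = length (filter (λ M → isUpperDiagonalCNM? M ×-dec firstOneAfter? M k) (allMatrices n))

{-# OPTIONS --safe #-}
module Submission where

-- Let u(n) be the number of upper-diagonal CNMs of size n.  A vertex at (i , n - i) has the leaves
-- in rows i and i + 1 as its children, which are alone in column n + 1 - i and in row i + 1; deleting
-- that row and column is a bijection onto the upper-diagonal CNMs of size n - 1.
--
-- Let P(i) count the CNMs whose i-th leaf has a vertex to its left.  When (i , n - i) is empty and
-- exactly one of the leaves i and i + 1 has a vertex to its left, exchanging rows i and i + 1 and
-- columns n - i and n + 1 - i gives a CNM in which it is the other one.  When (i , n - i) is a vertex,
-- only leaf i has a vertex to its left.  Hence P(i) - P(i + 1) = u(n - 1), and since P(1) = u(n) and
-- P(n) = 0 we get u(n) = (n - 1) u(n - 1), that is u(n) = (n - 1)!.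
--
-- By the contraction, f(n , k + 1) counts the CNMs of size n - 1 whose first k cells (i , n - 1 - i)
-- are empty.  Splitting these according to the next cell gives f(n , k + 2) + f(n - 1 , k) = f(n , k + 1),
-- and the sum satisfies the same recurrence by Pascal's rule.

open import Defs
import Data.Integer.Properties as ℤ
open import Algebra.Properties.CommutativeMonoid.Sum ℤ.+-0-commutativeMonoid using (sum-init-last; ∑-distrib-+; sum-cong-≗)
open import Algebra.Properties.AbelianGroup ℤ.+-0-abelianGroup using (∙-cancelʳ)
open import Data.Bool using (Bool; true; false; T)
open import Data.Bool.Properties using (¬-not) renaming (_≟_ to _≟ᵇ_)
open import Data.Fin as Fin using (Fin; toℕ; fromℕ; fromℕ<; inject₁; opposite)
open import Data.Fin.Induction using (>-wellFounded) renaming (<-wellFounded to <ᶠ-wellFounded)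
open import Data.Fin.Properties using (toℕ<n; toℕ-fromℕ<; toℕ-fromℕ; toℕ-inject₁; opposite-prop; any?) renaming (_<?_ to _<ᶠ?_; <-cmp to <ᶠ-cmp)
open import Data.Integer as ℤ using (ℤ; +_; -1ℤ; _*_; _^_)
open import Data.Integer.Tactic.RingSolver using (solve-∀)
open import Data.List using (List; []; _∷_; _++_; length; filter; allFin; cartesianProduct)
open import Data.List.Membership.Propositional using (_∈_)
open import Data.List.Membership.Propositional.Properties using (∈-∃++; ∈-++⁻; ∈-++⁺ˡ; ∈-++⁺ʳ; ∈-filter⁺; ∈-filter⁻; ∈-cartesianProduct⁺; ∈-allFin)
open import Data.List.Properties using (length-++; filter-≐; filter-none)
open import Data.List.Relation.Unary.All as All using ([]; _∷_)
open import Data.List.Relation.Unary.AllPairs using ([]; _∷_)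
open import Data.List.Relation.Unary.Any using (here; there)
open import Data.List.Relation.Unary.Unique.Propositional using (Unique)
open import Data.Nat as ℕ using (ℕ; zero; suc; pred; _+_; _∸_; _!; _≡ᵇ_; _≤_; _<_; z≤n; s≤s; s≤s⁻¹; _≟_; _≤?_; _<?_)
open import Data.Nat.Combinatorics using (_C_; nCk+nC[k+1]≡[n+1]C[k+1])
open import Data.Nat.Induction using (<-wellFounded)
open import Data.Nat.Properties hiding (_≟_; _≤?_; _<?_)
open import Data.Product using (_×_; _,_; ∃; ∃₂; proj₁; proj₂)
open import Data.Sum as Sum using (_⊎_; inj₁; inj₂)
open import Data.Unit using (⊤; tt)
open import Data.Vec using (Vec; []; _∷_; lookup; tabulate; replicate)
open import Data.Vec.Properties using (tabulate∘lookup; tabulate-cong)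
open import Function using (id; _∘_)
open import Induction.WellFounded using (Acc; acc)
open import Relation.Binary.Definitions using (tri<; tri≈; tri>)
open import Relation.Binary.PropositionalEquality using (_≡_; _≢_; refl; sym; trans; cong; cong₂; subst; subst₂; module ≡-Reasoning)
open import Relation.Nullary using (¬_; Dec; yes; no; contradiction; ¬?; _×-dec_; _→-dec_)
open import Relation.Nullary.Decidable using (map′)
import Data.List.Relation.Unary.Unique.Propositional.Properties as Unique

-- Boolean grids and staircase grids

Grid : Set
Grid = ℕ → ℕ → Bool

-- Rows and columns of a grid are numbered from 0.
Dot : Grid → ℕ → ℕ → Set
Dot g i j = g i j ≡ true

infix 4 _≐_
_≐_ : Grid → Grid → Set
g ≐ h = ∀ i j → g i j ≡ h i j

Above Left : Grid → ℕ → ℕ → Set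
Above g i j = ∃ λ i′ → i′ < i × Dot g i′ j
Left  g i j = ∃ λ j′ → j′ < j × Dot g i j′

-- The upper-diagonal CNMs of size N + 1.  The last vertex of a row is a leaf, so all vertices lie on or
-- above the antidiagonal i + j = N; a vertex strictly above it has leaves to its right and below it and
-- hence two children, so completeness needs no separate condition.
record Staircase (N : ℕ) (g : Grid) : Set where
  field
    within    : ∀ {i j} → Dot g i j → i + j ≤ N
    boundary  : ∀ {i j} → i + j ≡ N → Dot g i j
    exclusive : ∀ {i j} → Dot g i j → Above g i j → ¬ Left g i j
    supported : ∀ {i j} → Dot g i j → ¬ (i ≡ 0 × j ≡ 0) → Above g i j ⊎ Left g i j

module _ {N g h} (g≐h : g ≐ h) (G : Staircase N g) where
  open Staircase G
  private
    to : ∀ {i j} → Dot g i j → Dot h i j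
    to {i} {j} = trans (sym (g≐h i j))
    from : ∀ {i j} → Dot h i j → Dot g i j
    from {i} {j} = trans (g≐h i j)

  Staircase-resp : Staircase N h
  Staircase-resp = record
    { within    = λ v → within (from v)
    ; boundary  = λ e → to (boundary e)
    ; exclusive = λ { v (i , i< , u) (j , j< , w) →
        exclusive (from v) (i , i< , from u) (j , j< , from w) }
    ; supported = λ v r → Sum.map
        (λ { (i , i< , u) → i , i< , to u }) (λ { (j , j< , u) → j , j< , to u })
        (supported (from v) r)
    }

-- Contraction and expansion at a corner

-- The skipped value is a + 1, not a as in Fin.punchIn.
punch : ℕ → ℕ → ℕ
punch a       zero    = zero
punch zero    (suc i) = suc (suc i)
punch (suc a) (suc i) = suc (punch a i)

-- A view of an index as either the inserted line or the shifted copy of an old one, so that lines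
-- can be told apart by pattern matching.
data Gap (a : ℕ) : ℕ → Set where
  gap  : Gap a (suc a)
  past : ∀ i → Gap a (punch a i)

gap? : ∀ a i → Gap a i
gap? a       zero          = past zero
gap? zero    (suc zero)    = gap
gap? zero    (suc (suc i)) = past (suc i)
gap? (suc a) (suc i) with gap? a i
... | gap    = gap
... | past j = past (suc j)

gap?-gap : ∀ a → gap? a (suc a) ≡ gap
gap?-gap zero    = refl
gap?-gap (suc a) rewrite gap?-gap a = refl

gap?-past : ∀ a i → gap? a (punch a i) ≡ past i
gap?-past zero    zero    = refl
gap?-past (suc a) zero    = refl
gap?-past zero    (suc i) = refl
gap?-past (suc a) (suc i) rewrite gap?-past a i = refl

punch-low : ∀ {a i} → i ≤ a → punch a i ≡ i
punch-low z≤n     = refl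
punch-low (s≤s p) = cong suc (punch-low p)

punch-high : ∀ {a i} → a < i → punch a i ≡ suc i
punch-high {zero}  (s≤s _) = refl
punch-high {suc a} (s≤s p) = cong suc (punch-high p)

punch-increasing : ∀ a i → i ≤ punch a i
punch-increasing a       zero    = z≤n
punch-increasing zero    (suc i) = n≤1+n _
punch-increasing (suc a) (suc i) = s≤s (punch-increasing a i)

punch-mono-< : ∀ a {i j} → i < j → punch a i < punch a j
punch-mono-< zero    {zero}  (s≤s _) = s≤s z≤n
punch-mono-< (suc a) {zero}  (s≤s _) = s≤s z≤n
punch-mono-< zero    {suc i} (s≤s p) = s≤s (s≤s p)
punch-mono-< (suc a) {suc i} (s≤s p) = s≤s (punch-mono-< a p)

punch-cancel-< : ∀ a {i j} → punch a i < punch a j → i < j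
punch-cancel-< a {i} {j} p with <-cmp i j
... | tri< i<j _ _  = i<j
... | tri≈ _ refl _ = contradiction p (<-irrefl refl)
... | tri> _ _ j<i  = contradiction p (<-asym (punch-mono-< a j<i))

punch-injective : ∀ a {i j} → punch a i ≡ punch a j → i ≡ j
punch-injective a {i} {j} e with <-cmp i j
... | tri< i<j _ _ = contradiction e (<⇒≢ (punch-mono-< a i<j))
... | tri≈ _ i≡j _ = i≡j
... | tri> _ _ j<i = contradiction (sym e) (<⇒≢ (punch-mono-< a j<i))

punch-fixes : ∀ a → punch a a ≡ a
punch-fixes a = punch-low ≤-refl

punch-≤-suc : ∀ a i → punch a i ≤ suc i
punch-≤-suc a i with i ≤? a
... | yes i≤a = ≤-trans (≤-reflexive (punch-low i≤a)) (n≤1+n i)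
... | no  i≰a = ≤-reflexive (punch-high (≰⇒> i≰a))

-- Below the antidiagonal through (a , b), at most one of the two coordinates is shifted.
punch-+-≤ : ∀ {a b i j} → i + j ≤ a + b → punch a i + punch b j ≤ suc (a + b)
punch-+-≤ {a} {b} {i} {j} p with i ≤? a
... | yes i≤a = begin
  punch a i + punch b j ≡⟨ cong (_+ punch b j) (punch-low i≤a) ⟩
  i + punch b j         ≤⟨ +-monoʳ-≤ i (punch-≤-suc b j) ⟩
  i + suc j             ≡⟨ +-suc i j ⟩
  suc (i + j)           ≤⟨ s≤s p ⟩
  suc (a + b)           ∎
  where open ≤-Reasoning
... | no i≰a with j ≤? b
...   | yes j≤b = begin
  punch a i + punch b j ≡⟨ cong (λ x → punch a i + x) (punch-low j≤b) ⟩
  punch a i + j         ≤⟨ +-monoˡ-≤ j (punch-≤-suc a i) ⟩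
  suc (i + j)           ≤⟨ s≤s p ⟩
  suc (a + b)           ∎
  where open ≤-Reasoning
...   | no j≰b = contradiction (+-mono-≤ (<⇒≤ (≰⇒> i≰a)) (≰⇒> j≰b))
                   (<⇒≱ (subst (i + j <_) (sym (+-suc a b)) (s≤s p)))

-- A shifted coordinate gains exactly one and the other never drops, so the sum grows unless neither
-- is shifted.
punch-+-cases : ∀ {a b} i j → (i ≤ a × j ≤ b) ⊎ suc (i + j) ≤ punch a i + punch b j
punch-+-cases {a} {b} i j with i ≤? a
... | no i≰a = inj₂ (+-mono-≤ (≤-reflexive (sym (punch-high (≰⇒> i≰a)))) (punch-increasing b j))
... | yes i≤a with j ≤? b
...   | yes j≤b = inj₁ (i≤a , j≤b)
...   | no  j≰b = inj₂ (subst (_≤ punch a i + punch b j) (+-suc i j)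
                    (+-mono-≤ (punch-increasing a i) (≤-reflexive (sym (punch-high (≰⇒> j≰b))))))

punch-+-≤⁻¹ : ∀ {a b i j} → punch a i + punch b j ≤ suc (a + b) → i + j ≤ a + b
punch-+-≤⁻¹ {a} {b} {i} {j} p with punch-+-cases {a} {b} i j
... | inj₁ (i≤a , j≤b) = +-mono-≤ i≤a j≤b
... | inj₂ q           = s≤s⁻¹ (≤-trans q p)

-- Two shifts would need `(i , j)` past the antidiagonal through `(a , b)`, so at most one unit was
-- added.
punch-+-≡⁻¹ : ∀ {a b i j} → punch a i + punch b j ≡ suc (a + b) → i + j ≡ a + b
punch-+-≡⁻¹ {a} {b} {i} {j} e =
  ≤-antisym below (s≤s⁻¹ (≤-trans (≤-reflexive (sym e)) bound))
  where
  below : i + j ≤ a + b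
  below = punch-+-≤⁻¹ {a} {b} {i} {j} (≤-reflexive e)

  bound : punch a i + punch b j ≤ suc (i + j)
  bound with i ≤? a | j ≤? b
  ... | yes i≤a | _ = subst₂ _≤_ (cong (_+ punch b j) (sym (punch-low i≤a))) (+-suc i j)
                        (+-monoʳ-≤ i (punch-≤-suc b j))
  ... | no _ | yes j≤b = subst (λ x → punch a i + x ≤ suc (i + j)) (sym (punch-low j≤b))
                        (+-monoˡ-≤ j (punch-≤-suc a i))
  ... | no i≰a | no j≰b =
    contradiction below (<⇒≱ (+-mono-<-≤ (≰⇒> i≰a) (<⇒≤ (≰⇒> j≰b))))

-- Without any shift, `i ≤ a` and `j ≤ b` with equal sums force `(i , j)` to be `(a , b)`; this one
-- cell stays in place and is the corner.
punch-+-≡ : ∀ {a b i j} → i + j ≡ a + b → (i ≡ a × j ≡ b) ⊎ punch a i + punch b j ≡ suc (a + b)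
punch-+-≡ {a} {b} {i} {j} e with punch-+-cases {a} {b} i j
... | inj₂ q = inj₂ (≤-antisym (punch-+-≤ {a} {b} {i} {j} (≤-reflexive e))
                   (subst (λ x → suc x ≤ punch a i + punch b j) e q))
... | inj₁ (i≤a , j≤b) with i ≟ a
...   | yes refl = inj₁ (refl , +-cancelˡ-≡ i _ _ e)
...   | no  i≢a  = contradiction e (<⇒≢ (+-mono-<-≤ (≤∧≢⇒< i≤a i≢a) j≤b))

contract : ℕ → ℕ → Grid → Grid
contract a b g i j = g (punch a i) (punch b j)

-- The inserted row carries only a leaf in column `b`, the inserted column only one in row `a`. At
-- their crossing `j` is `suc b`, so the value is `false`.
expandAt : ∀ {a b i j} → Grid → Gap a i → Gap b j → Bool
expandAt {b = b} {j = j} g gap      _        = j ≡ᵇ b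
expandAt {a = a}         g (past i) gap      = i ≡ᵇ a
expandAt                 g (past i) (past j) = g i j

expand : ℕ → ℕ → Grid → Grid
expand a b g i j = expandAt g (gap? a i) (gap? b j)

module _ {a b : ℕ} {g : Grid} where

  expand-row : ∀ j → expand a b g (suc a) j ≡ (j ≡ᵇ b)
  expand-row j rewrite gap?-gap a = refl

  expand-column : ∀ i → expand a b g (punch a i) (suc b) ≡ (i ≡ᵇ a)
  expand-column i rewrite gap?-past a i | gap?-gap b = refl

  expand-punch : ∀ i j → expand a b g (punch a i) (punch b j) ≡ g i j
  expand-punch i j rewrite gap?-past a i | gap?-past b j = refl

≡ᵇ-true⇒≡ : ∀ {m n} → (m ≡ᵇ n) ≡ true → m ≡ n
≡ᵇ-true⇒≡ {m} {n} e = ≡ᵇ⇒≡ m n (subst T (sym e) tt)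

≡ᵇ-refl : ∀ n → (n ≡ᵇ n) ≡ true
≡ᵇ-refl zero    = refl
≡ᵇ-refl (suc n) = ≡ᵇ-refl n

module _ {a b : ℕ} {g : Grid} (G : Staircase (a + b) g) where
  open Staircase G
  private
    h : Grid
    h = expand a b g

    new-row : ∀ {j} → Dot h (suc a) j → j ≡ b
    new-row {j} v = ≡ᵇ-true⇒≡ (trans (sym (expand-row {a} {b} {g} j)) v)

    new-column : ∀ {i} → Dot h (punch a i) (suc b) → i ≡ a
    new-column {i} v = ≡ᵇ-true⇒≡ (trans (sym (expand-column {a} {b} {g} i)) v)

    old : ∀ i j → Dot h (punch a i) (punch b j) → Dot g i j
    old i j = trans (sym (expand-punch {a} {b} {g} i j))

    lift : ∀ i j → Dot g i j → Dot h (punch a i) (punch b j)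
    lift i j = trans (expand-punch {a} {b} {g} i j)

    right-leaf : Dot h a (suc b)
    right-leaf = subst (λ x → Dot h x (suc b)) (punch-fixes a)
      (trans (expand-column {a} {b} {g} a) (≡ᵇ-refl a))

    lower-leaf : Dot h (suc a) b
    lower-leaf = trans (expand-row {a} {b} {g} b) (≡ᵇ-refl b)

    old-column : ∀ {i} → Dot h (punch a i) b → i ≤ a
    old-column {i} v = +-cancelʳ-≤ b i a
      (within (old i b (subst (Dot h (punch a i)) (sym (punch-fixes b)) v)))

    old-row : ∀ {j} → Dot h a (punch b j) → j ≤ b
    old-row {j} v = +-cancelˡ-≤ a j b
      (within (old a j (subst (λ x → Dot h x (punch b j)) (sym (punch-fixes a)) v)))

  -- The leaf `(a , b)` of `g` is not shifted and becomes the parent of the two inserted leaves.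
  expand-corner : Dot (expand a b g) a b
  expand-corner = subst₂ (Dot h) (punch-fixes a) (punch-fixes b) (lift a b (boundary refl))

  private
    within′ : ∀ {i j} → Gap a i → Gap b j → Dot h i j → i + j ≤ suc (a + b)
    within′ gap      _        v = ≤-reflexive (cong (λ x → suc a + x) (new-row v))
    within′ (past i) gap      v with refl ← new-column {i} v =
      ≤-reflexive (trans (cong (_+ suc b) (punch-fixes a)) (+-suc a b))
    within′ (past i) (past j) v = punch-+-≤ {a} {b} {i} {j} (within (old i j v))

    boundary′ : ∀ {i j} → Gap a i → Gap b j → i + j ≡ suc (a + b) → Dot h i j
    boundary′ {j = j} gap _ e =
      subst (Dot h (suc a)) (sym (+-cancelˡ-≡ a j b (suc-injective e))) lower-leaf
    boundary′ (past i) gap e = subst (λ x → Dot h x (suc b))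
      (sym (+-cancelʳ-≡ (suc b) _ _ (trans e (sym (+-suc a b))))) right-leaf
    boundary′ (past i) (past j) e = lift i j (boundary (punch-+-≡⁻¹ {a} {b} {i} {j} e))

    -- An inserted leaf is alone on its inserted line. It is never above or left of an old vertex,
    -- because `g` has nothing below row `a` in column `b` and nothing right of column `b` in row
    -- `a`. In the remaining case all three vertices are old.
    exclusive′ : ∀ {i j i′ j′} → Gap a i → Gap b j → Gap a i′ → Gap b j′ →
      Dot h i j → i′ < i → Dot h i′ j → j′ < j → ¬ Dot h i j′
    exclusive′ gap _ _ _ v _ _ j′<j w =
      contradiction (trans (new-row w) (sym (new-row v))) (<⇒≢ j′<j)
    exclusive′ (past i) gap p _ v i′<i u _ _ with refl ← new-column {i} v | p
    ... | gap     = contradiction (≤-trans i′<i (punch-≤-suc _ _)) (<-irrefl refl)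
    ... | past i″ with refl ← new-column {i″} u = contradiction i′<i (<-irrefl refl)
    exclusive′ (past i) (past j) gap _ v i′<i u _ _ =
      contradiction (punch-cancel-< a (≤-trans (s≤s (≤-reflexive (punch-fixes a))) (<⇒≤ i′<i)))
        (≤⇒≯ (old-column (subst (Dot h (punch a i)) (new-row u) v)))
    exclusive′ (past i) (past j) (past _) gap v _ _ j′<j w =
      contradiction (punch-cancel-< b (≤-trans (s≤s (≤-reflexive (punch-fixes b))) (<⇒≤ j′<j)))
        (≤⇒≯ (old-row (subst (λ x → Dot h x (punch b j))
          (trans (cong (punch a) (new-column {i} w)) (punch-fixes a)) v)))
    exclusive′ (past i) (past j) (past i′) (past j′) v i′<i u j′<j w =
      exclusive (old i j v)
        (i′ , punch-cancel-< a i′<i , old i′ j u) (j′ , punch-cancel-< b j′<j , old i j′ w)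

    supported′ : ∀ {i j} → Gap a i → Gap b j → Dot h i j → ¬ (i ≡ 0 × j ≡ 0) → Above h i j ⊎ Left h i j
    supported′ gap _ v _ = inj₁ (a , ≤-refl , subst (Dot h a) (sym (new-row v)) expand-corner)
    supported′ (past i) gap v _ = inj₂ (b , ≤-refl ,
      subst (λ x → Dot h x b)
        (sym (trans (cong (punch a) (new-column {i} v)) (punch-fixes a))) expand-corner)
    supported′ (past i) (past j) v r = Sum.map
      (λ (i′ , i′<i , u) → punch a i′ , punch-mono-< a i′<i , lift i′ j u)
      (λ (j′ , j′<j , u) → punch b j′ , punch-mono-< b j′<j , lift i j′ u)
      (supported (old i j v) λ { (refl , refl) → r (refl , refl) })

  expand-Staircase : Staircase (suc (a + b)) (expand a b g)
  expand-Staircase = record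
    { within    = λ {i} {j} → within′ (gap? a i) (gap? b j)
    ; boundary  = λ {i} {j} → boundary′ (gap? a i) (gap? b j)
    ; exclusive = λ { {i} {j} v (i′ , i′<i , u) (j′ , j′<j , w) →
        exclusive′ (gap? a i) (gap? b j) (gap? a i′) (gap? b j′) v i′<i u j′<j w }
    ; supported = λ {i} {j} → supported′ (gap? a i) (gap? b j)
    }

module _ {a b : ℕ} {g : Grid} (G : Staircase (suc (a + b)) g) (corner : Dot g a b) where
  open Staircase G

  -- The corner lies above the leaf `(suc a , b)`, so exclusivity forbids vertices to its left;
  -- those to its right would pass the antidiagonal.
  lower-row : ∀ {j} → Dot g (suc a) j → j ≡ b
  lower-row {j} v with <-cmp j b
  ... | tri≈ _ e _ = e
  ... | tri< j<b _ _ = contradiction (j , j<b , v)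
    (exclusive (boundary refl) (a , ≤-refl , corner))
  ... | tri> _ _ b<j = contradiction (+-cancelˡ-≤ (suc a) j b (within v)) (<⇒≱ b<j)

  right-column : ∀ {i} → Dot g i (suc b) → i ≡ a
  right-column {i} v with <-cmp i a
  ... | tri≈ _ e _ = e
  ... | tri< i<a _ _ = contradiction (b , ≤-refl , corner)
    (exclusive (boundary (+-suc a b)) (i , i<a , v))
  ... | tri> _ _ a<i = contradiction
    (+-cancelʳ-≤ (suc b) i a (subst (i + suc b ≤_) (sym (+-suc a b)) (within v))) (<⇒≱ a<i)

  private
    -- No support is lost: the deleted vertices are leaves, with nothing below them or to their
    -- right.
    supported′ : ∀ {i j} → Dot g (punch a i) (punch b j) →
      Above g (punch a i) (punch b j) ⊎ Left g (punch a i) (punch b j) →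
      Above (contract a b g) i j ⊎ Left (contract a b g) i j
    supported′ {i} {j} v (inj₁ (i′ , i′< , u)) with gap? a i′
    ... | past i″ = inj₁ (i″ , punch-cancel-< a i′< , u)
    ... | gap = contradiction (+-cancelʳ-≤ b (punch a i) (suc a)
      (within (subst (Dot g (punch a i)) (lower-row u) v))) (<⇒≱ i′<)
    supported′ {i} {j} v (inj₂ (j′ , j′< , u)) with gap? b j′
    ... | past j″ = inj₂ (j″ , punch-cancel-< b j′< , u)
    ... | gap = contradiction (+-cancelˡ-≤ a (punch b j) (suc b)
      (subst (a + punch b j ≤_) (sym (+-suc a b))
        (within (subst (λ x → Dot g x (punch b j)) (right-column u) v)))) (<⇒≱ j′<)

    boundary′ : ∀ {i j} → i + j ≡ a + b → Dot g (punch a i) (punch b j)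
    boundary′ {i} {j} e with punch-+-≡ {a} {b} {i} {j} e
    ... | inj₁ (refl , refl) = subst₂ (Dot g) (sym (punch-fixes a)) (sym (punch-fixes b)) corner
    ... | inj₂ e′ = boundary e′

  contract-Staircase : Staircase (a + b) (contract a b g)
  contract-Staircase = record
    { within    = λ {i} {j} v → punch-+-≤⁻¹ {a} {b} {i} {j} (within v)
    ; boundary  = λ {i} {j} → boundary′ {i} {j}
    ; exclusive = λ { v (i′ , i′<i , u) (j′ , j′<j , w) → exclusive v
        (punch a i′ , punch-mono-< a i′<i , u) (punch b j′ , punch-mono-< b j′<j , w) }
    ; supported = λ v r → supported′ v (supported v λ (ei , ej) →
        r (punch-injective a ei , punch-injective b ej))
    }

Bool-ext : ∀ {x y : Bool} → (x ≡ true → y ≡ true) → (y ≡ true → x ≡ true) → x ≡ y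
Bool-ext {true}  {_}     p _ = sym (p refl)
Bool-ext {false} {true}  _ q = q refl
Bool-ext {false} {false} _ _ = refl

expand-injective : ∀ {a b g h} → expand a b g ≐ expand a b h → g ≐ h
expand-injective {a} {b} {g} {h} e i j =
  trans (sym (expand-punch {a} {b} {g} i j))
    (trans (e (punch a i) (punch b j)) (expand-punch {a} {b} {h} i j))

-- The deleted row and column are determined by `lower-row` and `right-column`.
contract-injective : ∀ {a b g h} → Staircase (suc (a + b)) g → Dot g a b →
  Staircase (suc (a + b)) h → Dot h a b → contract a b g ≐ contract a b h → g ≐ h
contract-injective {a} {b} {g} {h} G cg H ch e i j with gap? a i | gap? b j
... | past i′ | past j′ = e i′ j′
... | gap | _ = Bool-ext
  (λ v → subst (Dot h (suc a)) (sym (lower-row G cg v)) (Staircase.boundary H refl))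
  (λ v → subst (Dot g (suc a)) (sym (lower-row H ch v)) (Staircase.boundary G refl))
... | past i′ | gap = Bool-ext
  (λ v → subst (λ x → Dot h x (suc b)) (sym (right-column G cg v)) (Staircase.boundary H (+-suc a b)))
  (λ v → subst (λ x → Dot g x (suc b)) (sym (right-column H ch v)) (Staircase.boundary G (+-suc a b)))

-- Exchanging two adjacent leaves

transpose : ℕ → ℕ → ℕ
transpose zero    zero          = 1
transpose zero    (suc zero)    = 0
transpose zero    (suc (suc i)) = suc (suc i)
transpose (suc a) zero          = zero
transpose (suc a) (suc i)       = suc (transpose a i)

transpose-involutive : ∀ a i → transpose a (transpose a i) ≡ i
transpose-involutive zero    zero          = refl
transpose-involutive zero    (suc zero)    = refl
transpose-involutive zero    (suc (suc i)) = refl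
transpose-involutive (suc a) zero          = refl
transpose-involutive (suc a) (suc i)       = cong suc (transpose-involutive a i)

transpose-low : ∀ a → transpose a a ≡ suc a
transpose-low zero    = refl
transpose-low (suc a) = cong suc (transpose-low a)

transpose-high : ∀ a → transpose a (suc a) ≡ a
transpose-high zero    = refl
transpose-high (suc a) = cong suc (transpose-high a)

transpose-below : ∀ {a i} → i < a → transpose a i ≡ i
transpose-below {suc a} {zero}  _       = refl
transpose-below {suc a} {suc i} (s≤s p) = cong suc (transpose-below p)

transpose-above : ∀ {a i} → suc a < i → transpose a i ≡ i
transpose-above {zero}  {suc (suc i)} _       = refl
transpose-above {zero}  {suc zero}    (s≤s ())
transpose-above {suc a} {suc i}       (s≤s p) = cong suc (transpose-above p)

data Transposed (a : ℕ) : ℕ → Set where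
  low   : Transposed a a
  high  : Transposed a (suc a)
  fixed : ∀ {i} → i ≢ a → i ≢ suc a → transpose a i ≡ i → Transposed a i

transposed : ∀ a i → Transposed a i
transposed a i with <-cmp i a
... | tri< i<a i≢a _ = fixed i≢a (<⇒≢ (m<n⇒m<1+n i<a)) (transpose-below i<a)
... | tri≈ _ refl _ = low
... | tri> _ i≢a a<i with <-cmp i (suc a)
...   | tri< i<1+a _ _  = contradiction (s≤s⁻¹ i<1+a) (<⇒≱ a<i)
...   | tri≈ _ refl _   = high
...   | tri> _ i≢1+a 1+a<i = fixed i≢a i≢1+a (transpose-above 1+a<i)

-- An adjacent transposition has a single inversion.
transpose-mono-< : ∀ a {i j} → i < j → transpose a i < transpose a j ⊎ (i ≡ a × j ≡ suc a)
transpose-mono-< zero    {zero}        {suc zero}    _ = inj₂ (refl , refl)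
transpose-mono-< zero    {zero}        {suc (suc j)} _ = inj₁ (s≤s (s≤s z≤n))
transpose-mono-< zero    {suc zero}    {suc (suc j)} _ = inj₁ (s≤s z≤n)
transpose-mono-< zero    {suc zero}    {suc zero}    (s≤s ())
transpose-mono-< zero    {suc (suc i)} {suc zero}    (s≤s ())
transpose-mono-< zero    {suc (suc i)} {suc (suc j)} p = inj₁ p
transpose-mono-< (suc a) {zero}        {suc j}       _ = inj₁ (s≤s z≤n)
transpose-mono-< (suc a) {suc i}       {suc j} (s≤s p) =
  Sum.map s≤s (λ { (refl , refl) → refl , refl }) (transpose-mono-< a p)

transpose-zero : ∀ {a i} → 0 < a → transpose a i ≡ 0 → i ≡ 0
transpose-zero {a} {i} 0<a e =
  trans (sym (transpose-involutive a i)) (trans (cong (transpose a) e) (transpose-below 0<a))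

≤∧≢suc⇒≤ : ∀ {m n} → m ≤ suc n → m ≢ suc n → m ≤ n
≤∧≢suc⇒≤ p q = s≤s⁻¹ (≤∧≢⇒< p q)

-- Lowering one coordinate by one could bring a cell inside only from the next antidiagonal. In row
-- `suc a` or column `suc b` that cell is `(suc a , suc b)`, whose image is the corner.
transpose-+-≤ : ∀ {a b i j} → transpose a i + transpose b j ≤ suc (a + b) →
  i + j ≤ suc (a + b) ⊎ (i ≡ suc a × j ≡ suc b)
transpose-+-≤ {a} {b} {i} {j} p with transposed a i | transposed b j
... | high | high = inj₂ (refl , refl)
... | low  | low  = inj₁ (n≤1+n _)
... | low  | high = inj₁ (≤-reflexive (+-suc a b))
... | high | low  = inj₁ ≤-refl
... | low  | fixed _ _ e = inj₁ (≤-trans (n≤1+n _)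
  (subst₂ (λ x y → x + y ≤ suc (a + b)) (transpose-low a) e p))
... | fixed _ _ e | low  = inj₁ (≤-trans (+-monoʳ-≤ i (n≤1+n b))
  (subst₂ (λ x y → x + y ≤ suc (a + b)) e (transpose-low b) p))
... | fixed _ _ e | fixed _ _ e′ = inj₁ (subst₂ (λ x y → x + y ≤ suc (a + b)) e e′ p)
... | high | fixed _ j≢1+b e = inj₁ (s≤s (+-monoʳ-≤ a (≤∧≢suc⇒≤ (+-cancelˡ-≤ a j (suc b)
  (subst (a + j ≤_) (sym (+-suc a b))
    (subst₂ (λ x y → x + y ≤ suc (a + b)) (transpose-high a) e p))) j≢1+b)))
... | fixed _ i≢1+a e | high = inj₁ (subst (i + suc b ≤_) (+-suc a b) (+-monoˡ-≤ (suc b) (≤∧≢suc⇒≤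
  (+-cancelʳ-≤ b i (suc a) (subst₂ (λ x y → x + y ≤ suc (a + b)) e (transpose-high b) p)) i≢1+a)))

-- The leaves of rows `a` and `suc a` change places; every other leaf avoids the exchanged rows and
-- columns.
transpose-+-≡ : ∀ {a b i j} → i + j ≡ suc (a + b) → transpose a i + transpose b j ≡ suc (a + b)
transpose-+-≡ {a} {b} {i} {j} e with transposed a i | transposed b j
... | fixed _ _ e₁ | fixed _ _ e₂ = trans (cong₂ _+_ e₁ e₂) e
... | low  | fixed _ j≢ _ = contradiction (+-cancelˡ-≡ a j (suc b) (trans e (sym (+-suc a b)))) j≢
... | high | fixed j≢ _ _ = contradiction (+-cancelˡ-≡ a j b (suc-injective e)) j≢
... | fixed _ i≢ _ | low  = contradiction (+-cancelʳ-≡ b i (suc a) e) i≢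
... | fixed i≢ _ _ | high = contradiction (+-cancelʳ-≡ (suc b) i a (trans e (sym (+-suc a b)))) i≢
... | low  | low  = contradiction e (<⇒≢ ≤-refl)
... | low  | high = cong₂ _+_ (transpose-low a) (transpose-high b)
... | high | low  = trans (cong₂ _+_ (transpose-high a) (transpose-low b)) (+-suc a b)
... | high | high = contradiction (sym e) (<⇒≢ (s≤s (+-monoʳ-< a ≤-refl)))

swap : ℕ → ℕ → Grid → Grid
swap a b g i j = g (transpose a i) (transpose b j)

swap-injective : ∀ {a b g h} → swap a b g ≐ swap a b h → g ≐ h
swap-injective {a} {b} {g} {h} e i j = subst₂ (λ x y → g x y ≡ h x y)
  (transpose-involutive a i) (transpose-involutive b j) (e (transpose a i) (transpose b j))

-- Under these conditions the swap never exchanges the relative order of two vertices of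
-- one row or one column.
record Swappable (a b : ℕ) (g : Grid) : Set where
  field
    row-positive    : 0 < a
    column-positive : 0 < b
    no-corner       : ¬ Dot g a b
    rows-disjoint   : ∀ {j} → Dot g a j → ¬ Dot g (suc a) j
    cols-disjoint   : ∀ {i} → Dot g i b → ¬ Dot g i (suc b)

module _ {a b : ℕ} {g : Grid} (G : Staircase (suc (a + b)) g) (S : Swappable a b g) where
  open Staircase G
  open Swappable S
  private
    h : Grid
    h = swap a b g

    σ τ : ℕ → ℕ
    σ = transpose a
    τ = transpose b

    above : ∀ {i j i′} → Dot g (σ i) (τ j) → i′ < i → Dot h i′ j → σ i′ < σ i
    above v p u with transpose-mono-< a p
    ... | inj₁ q = q
    ... | inj₂ (refl , refl) = contradiction (subst (λ x → Dot g x _) (transpose-low a) u)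
      (rows-disjoint (subst (λ x → Dot g x _) (transpose-high a) v))

    left : ∀ {i j j′} → Dot g (σ i) (τ j) → j′ < j → Dot h i j′ → τ j′ < τ j
    left v p u with transpose-mono-< b p
    ... | inj₁ q = q
    ... | inj₂ (refl , refl) = contradiction (subst (Dot g _) (transpose-low b) u)
      (cols-disjoint (subst (Dot g _) (transpose-high b) v))

    within′ : ∀ {i j} → Dot h i j → i + j ≤ suc (a + b)
    within′ {i} {j} v with transpose-+-≤ {a} {b} {i} {j} (within v)
    ... | inj₁ p = p
    ... | inj₂ (refl , refl) =
      contradiction (subst₂ (Dot g) (transpose-high a) (transpose-high b) v) no-corner

    supported′ : ∀ {i j} → Dot g (σ i) (τ j) → Above g (σ i) (τ j) ⊎ Left g (σ i) (τ j) →
      Above h i j ⊎ Left h i j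
    supported′ {i} {j} v (inj₁ (i′ , i′< , u)) with transpose-mono-< a i′<
    ... | inj₁ q = inj₁ (σ i′ , subst (σ i′ <_) (transpose-involutive a i) q ,
                         subst (λ x → Dot g x (τ j)) (sym (transpose-involutive a i′)) u)
    ... | inj₂ (refl , e) = contradiction (subst (λ x → Dot g x (τ j)) e v) (rows-disjoint u)
    supported′ {i} {j} v (inj₂ (j′ , j′< , u)) with transpose-mono-< b j′<
    ... | inj₁ q = inj₂ (τ j′ , subst (τ j′ <_) (transpose-involutive b j) q ,
                         subst (Dot g (σ i)) (sym (transpose-involutive b j′)) u)
    ... | inj₂ (refl , e) = contradiction (subst (Dot g (σ i)) e v) (cols-disjoint u)

  swap-Staircase : Staircase (suc (a + b)) (swap a b g)
  swap-Staircase = record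
    { within    = within′
    ; boundary  = λ {i} {j} e → boundary (transpose-+-≡ {a} {b} {i} {j} e)
    ; exclusive = λ { {i} {j} v (i′ , p , u) (j′ , q , w) → exclusive v
        (σ i′ , above {i} {j} v p u , u) (τ j′ , left {i} {j} v q w , w) }
    ; supported = λ {i} {j} v r → supported′ {i} {j} v (supported v λ (ei , ej) →
        r (transpose-zero row-positive ei , transpose-zero column-positive ej))
    }

module _ {a b : ℕ} {g : Grid} (G : Staircase (suc (a + b)) g) where
  open Staircase G
  private
    right-leaf : Dot g a (suc b)
    right-leaf = boundary (+-suc a b)

    lower-leaf : Dot g (suc a) b
    lower-leaf = boundary refl

    outside : ¬ Dot g (suc a) (suc b)
    outside v = <-irrefl refl (≤-trans (s≤s (≤-reflexive (sym (+-suc a b)))) (within v))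

  corner⇒left : Dot g a b → Left g a (suc b)
  corner⇒left v = b , ≤-refl , v

  corner⇒¬left : Dot g a b → ¬ Left g (suc a) b
  corner⇒¬left v = exclusive lower-leaf (a , ≤-refl , v)

  module _ (l : Left g a (suc b)) (¬l : ¬ Left g (suc a) b) (¬c : ¬ Dot g a b) where
    private
      -- Row `suc a` has nothing left of its leaf by `¬l`, and column `suc b` has nothing above its
      -- leaf by exclusivity with `l`; so each of these lines holds only its leaf.
      lower-row′ : ∀ {j} → Dot g (suc a) j → j ≡ b
      lower-row′ {j} v with <-cmp j b
      ... | tri< j<b _ _ = contradiction (j , j<b , v) ¬l
      ... | tri≈ _ e _   = e
      ... | tri> _ _ b<j = contradiction (+-cancelˡ-≤ (suc a) j b (within v)) (<⇒≱ b<j)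

      right-column′ : ∀ {i} → Dot g i (suc b) → i ≡ a
      right-column′ {i} v with <-cmp i a
      ... | tri< i<a _ _ = contradiction l (exclusive right-leaf (i , i<a , v))
      ... | tri≈ _ e _   = e
      ... | tri> _ _ a<i = contradiction (+-cancelʳ-≤ (suc b) i a
        (subst (i + suc b ≤_) (sym (+-suc a b)) (within v))) (<⇒≱ a<i)

      -- The vertex given by `l` is not in column `b`, the corner being empty.
      inner : Left g a b
      inner = let j , j<1+b , v = l in
        j , ≤∧≢⇒< (s≤s⁻¹ j<1+b) (λ e → ¬c (subst (Dot g a) e v)) , v

      j<b : proj₁ inner < b
      j<b = proj₁ (proj₂ inner)

      -- The leaf `(suc a , b)` must be supported from above, and not by the empty corner, hence
      -- from a row before `a`.
      row-positive′ : 0 < a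
      row-positive′ with supported lower-leaf (λ { (() , _) })
      ... | inj₂ l′ = contradiction l′ ¬l
      ... | inj₁ (i , i<1+a , v) with i ≟ a
      ...   | yes refl = contradiction v ¬c
      ...   | no i≢a   = ≤-<-trans z≤n (≤∧≢⇒< (s≤s⁻¹ i<1+a) i≢a)

      column-positive′ : 0 < b
      column-positive′ = ≤-<-trans z≤n j<b

    left-¬left⇒swappable : Swappable a b g
    left-¬left⇒swappable = record
      { row-positive    = row-positive′
      ; column-positive = column-positive′
      ; no-corner       = ¬c
      -- The only column of row `suc a` is `b`, so a shared column would put a vertex on the corner.
      ; rows-disjoint   = λ u v → ¬c (subst (Dot g a) (lower-row′ v) u)
      ; cols-disjoint   = λ u v → ¬c (subst (λ x → Dot g x b) (right-column′ v) u)
      }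

    -- The new row `a` is the old row `suc a`, whose only vertex moves to column `suc b`.
    swap-¬left : ¬ Left (swap a b g) a (suc b)
    swap-¬left (j , j<1+b , v) = <-irrefl j≡1+b j<1+b
      where
      j≡1+b : j ≡ suc b
      j≡1+b = trans (sym (transpose-involutive b j)) (trans
        (cong (transpose b) (lower-row′ (subst (λ x → Dot g x (transpose b j)) (transpose-low a) v)))
        (transpose-low b))

    swap-left : Left (swap a b g) (suc a) b
    swap-left = proj₁ inner , j<b ,
      subst₂ (Dot g) (sym (transpose-high a)) (sym (transpose-below j<b)) (proj₂ (proj₂ inner))

  module _ (¬l : ¬ Left g a (suc b)) (l : Left g (suc a) b) where
    private
      -- In this case row `a` and column `b` are the lines that hold only their leaf. The corner is
      -- therefore empty, and any conflict would need a vertex at `(suc a , suc b)`, past the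
      -- antidiagonal.
      row′ : ∀ {j} → Dot g a j → j ≡ suc b
      row′ {j} v with <-cmp j (suc b)
      ... | tri< j<1+b _ _ = contradiction (j , j<1+b , v) ¬l
      ... | tri≈ _ e _     = e
      ... | tri> _ _ 1+b<j = contradiction (+-cancelˡ-≤ a j (suc b)
        (subst (a + j ≤_) (sym (+-suc a b)) (within v))) (<⇒≱ 1+b<j)

      column′ : ∀ {i} → Dot g i b → i ≡ suc a
      column′ {i} v with <-cmp i (suc a)
      ... | tri< i<1+a _ _ = contradiction l (exclusive lower-leaf (i , i<1+a , v))
      ... | tri≈ _ e _     = e
      ... | tri> _ _ 1+a<i = contradiction (+-cancelʳ-≤ b i (suc a) (within v)) (<⇒≱ 1+a<i)

      row-positive′ : 0 < a
      row-positive′ with supported right-leaf (λ { (_ , ()) })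
      ... | inj₁ (i , i<a , v) = ≤-<-trans z≤n i<a
      ... | inj₂ l′ = contradiction l′ ¬l

    ¬left-left⇒swappable : Swappable a b g
    ¬left-left⇒swappable = record
      { row-positive    = row-positive′
      ; column-positive = ≤-<-trans z≤n (proj₁ (proj₂ l))
      ; no-corner       = λ v → <⇒≢ ≤-refl (row′ v)
      ; rows-disjoint   = λ u v → outside (subst (Dot g (suc a)) (row′ u) v)
      ; cols-disjoint   = λ u v → outside (subst (λ x → Dot g x (suc b)) (column′ u) v)
      }

    swap-left′ : Left (swap a b g) a (suc b)
    swap-left′ = let j , j<b , v = l in j , m<n⇒m<1+n j<b ,
      subst₂ (Dot g) (sym (transpose-low a)) (sym (transpose-below j<b)) v

    swap-¬left′ : ¬ Left (swap a b g) (suc a) b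
    swap-¬left′ (j , j<b , v) =
      <-irrefl (row′ (subst₂ (Dot g) (transpose-high a) (transpose-below j<b) v))
        (m<n⇒m<1+n j<b)

    swap-¬corner : ¬ Dot (swap a b g) a b
    swap-¬corner v = outside (subst₂ (Dot g) (transpose-low a) (transpose-low b) v)

-- Counting in duplicate-free lists

-- The image of the head is cut out of `ys`; by injectivity the images of the tail remain in the
-- rest.
length-injection : {A B : Set} (φ : A → B) {xs : List A} {ys : List B} → Unique xs →
  (∀ {x} → x ∈ xs → φ x ∈ ys) →
  (∀ {x y} → x ∈ xs → y ∈ xs → φ x ≡ φ y → x ≡ y) →
  length xs ≤ length ys
length-injection φ {[]} _ _ _ = z≤n
length-injection φ {x ∷ xs} {ys} (x∉xs ∷ u) into inj with ∈-∃++ (into (here refl))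
... | as , bs , refl = begin
  suc (length xs)          ≤⟨ s≤s (length-injection φ u into′ λ p q → inj (there p) (there q)) ⟩
  suc (length (as ++ bs))  ≡⟨ cong suc (length-++ as) ⟩
  suc (length as + length bs) ≡⟨ +-suc (length as) (length bs) ⟨
  length as + suc (length bs) ≡⟨ length-++ as ⟨
  length (as ++ φ x ∷ bs)  ∎
  where
  open ≤-Reasoning
  into′ : ∀ {y} → y ∈ xs → φ y ∈ as ++ bs
  into′ y∈xs with ∈-++⁻ as (into (there y∈xs))
  ... | inj₁ p         = ∈-++⁺ˡ p
  ... | inj₂ (there p) = ∈-++⁺ʳ as p
  ... | inj₂ (here e)  = contradiction (inj (here refl) (there y∈xs) (sym e)) (All.lookup x∉xs y∈xs)

length-filter-split : {A : Set} {P Q R : A → Set} (P? : ∀ x → Dec (P x)) (Q? : ∀ x → Dec (Q x))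
  (R? : ∀ x → Dec (R x)) → (∀ {x} → P x → Q x ⊎ R x) → (∀ {x} → Q x → P x) →
  (∀ {x} → R x → P x) → (∀ {x} → Q x → ¬ R x) → ∀ xs →
  length (filter P? xs) ≡ length (filter Q? xs) + length (filter R? xs)
length-filter-split P? Q? R? split QP RP QR [] = refl
length-filter-split P? Q? R? split QP RP QR (x ∷ xs)
  with ih ← length-filter-split P? Q? R? split QP RP QR xs | P? x | Q? x | R? x
... | yes _ | yes q | yes r = contradiction r (QR q)
... | yes _ | yes _ | no _  = cong suc ih
... | yes _ | no _  | yes _ = trans (cong suc ih) (sym (+-suc _ _))
... | yes p | no ¬q | no ¬r = contradiction (split p) Sum.[ ¬q , ¬r ]
... | no ¬p | yes q | _     = contradiction (QP q) ¬p
... | no ¬p | no _  | yes r = contradiction (RP r) ¬p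
... | no _  | no _  | no _  = ih

-- Matrices as grids

at : ∀ {A : Set} {n} → A → Vec A n → ℕ → A
at d []      _       = d
at d (x ∷ _) zero    = x
at d (_ ∷ v) (suc i) = at d v i

at-toℕ : ∀ {A : Set} {n} {d : A} (v : Vec A n) i → at d v (toℕ i) ≡ lookup v i
at-toℕ (_ ∷ _) Fin.zero    = refl
at-toℕ (_ ∷ v) (Fin.suc i) = at-toℕ v i

at-tabulate : ∀ {A : Set} {n} {d : A} (φ : ℕ → A) {i} → i < n →
  at d (tabulate {n = n} (λ k → φ (toℕ k))) i ≡ φ i
at-tabulate {n = suc _} φ {zero}  _       = refl
at-tabulate {n = suc _} φ {suc i} (s≤s p) = at-tabulate (φ ∘ suc) p

at-outside : ∀ {A : Set} {n} {d : A} (v : Vec A n) {i} → n ≤ i → at d v i ≡ d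
at-outside []      _               = refl
at-outside (_ ∷ v) {suc i} (s≤s p) = at-outside v p

at-replicate : ∀ {A : Set} n (d : A) i → at d (replicate n d) i ≡ d
at-replicate zero    d i       = refl
at-replicate (suc n) d zero    = refl
at-replicate (suc n) d (suc i) = at-replicate n d i

-- Padding with `false` keeps every vertex of the grid inside the matrix.
toGrid : ∀ {n} → Matrix n → Grid
toGrid {n} M i j = at false (at (replicate n false) M i) j

fromGrid : ∀ {n} → Grid → Matrix n
fromGrid g = tabulate λ i → tabulate λ j → g (toℕ i) (toℕ j)

module _ {n} (M : Matrix n) where

  toGrid-entry : ∀ i j → toGrid M (toℕ i) (toℕ j) ≡ entry M (i , j)
  toGrid-entry i j = trans (cong (λ v → at false v (toℕ j)) (at-toℕ M i)) (at-toℕ (lookup M i) j)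

  toGrid-row : ∀ {i j} → Dot (toGrid M) i j → i < n
  toGrid-row {i} {j} v with i <? n
  ... | yes p = p
  ... | no ¬p = contradiction
    (trans (sym v) (trans (cong (λ w → at false w j) (at-outside M (≮⇒≥ ¬p)))
      (at-replicate n false j))) λ ()

  toGrid-column : ∀ {i j} → Dot (toGrid M) i j → j < n
  toGrid-column {i} {j} v with j <? n
  ... | yes p = p
  ... | no ¬p = contradiction (trans (sym v) (at-outside (at (replicate n false) M i) (≮⇒≥ ¬p))) λ ()

  vertex⇒dot : ∀ {i j} → Vertex M (i , j) → Dot (toGrid M) (toℕ i) (toℕ j)
  vertex⇒dot {i} {j} = trans (toGrid-entry i j)

  dot⇒vertex : ∀ {i j} → Dot (toGrid M) (toℕ i) (toℕ j) → Vertex M (i , j)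
  dot⇒vertex {i} {j} = trans (sym (toGrid-entry i j))

  dot-position : ∀ {i j} → Dot (toGrid M) i j → ∃₂ λ (i′ j′ : Fin n) → toℕ i′ ≡ i × toℕ j′ ≡ j
  dot-position v = fromℕ< (toGrid-row v) , fromℕ< (toGrid-column v) , toℕ-fromℕ< _ , toℕ-fromℕ< _

  above⇒hasAbove : ∀ {i j} → Above (toGrid M) (toℕ i) (toℕ j) → HasAbove M (i , j)
  above⇒hasAbove (i′ , p , v) with k , _ , refl , _ ← dot-position v = k , p , dot⇒vertex v

  left⇒hasLeft : ∀ {i j} → Left (toGrid M) (toℕ i) (toℕ j) → HasLeft M (i , j)
  left⇒hasLeft (j′ , p , v) with _ , k , _ , refl ← dot-position v = k , p , dot⇒vertex v

  hasAbove⇒above : ∀ {i j} → HasAbove M (i , j) → Above (toGrid M) (toℕ i) (toℕ j)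
  hasAbove⇒above (i′ , p , v) = toℕ i′ , p , vertex⇒dot v

  hasLeft⇒left : ∀ {i j} → HasLeft M (i , j) → Left (toGrid M) (toℕ i) (toℕ j)
  hasLeft⇒left (j′ , p , v) = toℕ j′ , p , vertex⇒dot v

lookup-ext : ∀ {A : Set} {n} {u v : Vec A n} → (∀ i → lookup u i ≡ lookup v i) → u ≡ v
lookup-ext {u = u} {v} e =
  trans (sym (tabulate∘lookup u)) (trans (tabulate-cong e) (tabulate∘lookup v))

toGrid-injective : ∀ {n} {M M′ : Matrix n} → toGrid M ≐ toGrid M′ → M ≡ M′
toGrid-injective {M = M} {M′} e = lookup-ext λ i → lookup-ext λ j →
  trans (sym (toGrid-entry M i j)) (trans (e (toℕ i) (toℕ j)) (toGrid-entry M′ i j))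

-- Truncation to size `suc N` loses nothing, since `within` bounds both coordinates of a vertex by
-- `N`.
toGrid-fromGrid : ∀ {N g} → Staircase N g → toGrid (fromGrid {suc N} g) ≐ g
toGrid-fromGrid {N} {g} G i j = Bool-ext
  (λ v → trans (sym (inside (toGrid-row M v) (toGrid-column M {i} v))) v)
  (λ v → trans (inside (s≤s (m+n≤o⇒m≤o i (Staircase.within G v)))
                       (s≤s (m+n≤o⇒n≤o i (Staircase.within G v)))) v)
  where
  M : Matrix (suc N)
  M = fromGrid g
  inside : i < suc N → j < suc N → toGrid M i j ≡ g i j
  inside p q = trans
    (cong (λ v → at false v j) (at-tabulate (λ i → tabulate λ j → g i (toℕ j)) p))
    (at-tabulate (g i) q)

-- Upper-diagonal matrices are the staircase grids

least : ∀ {n} {P : Fin n → Set} → (∀ i → Dec (P i)) → ∃ P →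
  ∃ λ i → P i × (∀ j → j Fin.< i → ¬ P j)
least {P = P} P? (i , p) = go i p (<ᶠ-wellFounded i)
  where
  go : ∀ i → P i → Acc Fin._<_ i → ∃ λ i → P i × (∀ j → j Fin.< i → ¬ P j)
  go i p (acc rs) with any? (λ j → (j <ᶠ? i) ×-dec P? j)
  ... | yes (j , j<i , q) = go j q (rs j<i)
  ... | no none           = i , p , λ j j<i q → none (j , j<i , q)

idx-sum⇒diagonal : ∀ {N} {i j : Fin (suc N)} → idx i + idx j ≡ suc N + 1 → toℕ i + toℕ j ≡ N
idx-sum⇒diagonal {N} {i} {j} e = suc-injective (trans (sym (+-suc (toℕ i) (toℕ j)))
  (trans (suc-injective e) (+-comm N 1)))

diagonal⇒idx-sum : ∀ {N} {i j : Fin (suc N)} → toℕ i + toℕ j ≡ N → idx i + idx j ≡ suc N + 1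
diagonal⇒idx-sum {N} {i} {j} e = cong suc (trans (+-suc (toℕ i) (toℕ j))
  (trans (cong suc e) (+-comm 1 N)))

module _ {n} (M : Matrix n) where

  children-unique : ∀ q → Unique (children M q)
  children-unique q =
    Unique.filter⁺ (parent? M q) (Unique.cartesianProduct⁺ (Unique.allFin⁺ n) (Unique.allFin⁺ n))

  ∈-children⁺ : ∀ {q p} → Parent M q p → p ∈ children M q
  ∈-children⁺ {q} {i , j} = ∈-filter⁺ (parent? M q) (∈-cartesianProduct⁺ (∈-allFin i) (∈-allFin j))

  ∈-children⁻ : ∀ {q p} → p ∈ children M q → Parent M q p
  ∈-children⁻ {q} p∈ =
    proj₂ (∈-filter⁻ (parent? M q) {xs = cartesianProduct (allFin n) (allFin n)} p∈)

  -- Of two candidates, the upper one would be a nearer vertex above the lower one.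
  nearestAbove-unique : ∀ {q p p′} → NearestAbove M q p → NearestAbove M q p′ →
    Vertex M p → Vertex M p′ → p ≡ p′
  nearestAbove-unique {p = i , j} {i′ , _} (refl , q<i , _ , m) (refl , q<i′ , _ , m′) v v′
    with <ᶠ-cmp i i′
  ... | tri< i<i′ _ _ = contradiction (m′ i i<i′ v) (<⇒≱ q<i)
  ... | tri≈ _ refl _ = refl
  ... | tri> _ _ i′<i = contradiction (m i′ i′<i v′) (<⇒≱ q<i′)

  nearestLeft-unique : ∀ {q p p′} → NearestLeft M q p → NearestLeft M q p′ →
    Vertex M p → Vertex M p′ → p ≡ p′
  nearestLeft-unique {p = i , j} {_ , j′} (refl , q<j , _ , m) (refl , q<j′ , _ , m′) v v′
    with <ᶠ-cmp j j′
  ... | tri< j<j′ _ _ = contradiction (m′ j j<j′ v) (<⇒≱ q<j)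
  ... | tri≈ _ refl _ = refl
  ... | tri> _ _ j′<j = contradiction (m j′ j′<j v′) (<⇒≱ q<j′)

  -- With nothing to the right, every child lies below, where there is at most one.
  ¬right⇒¬two-children : ∀ {i j} → ¬ (∃ λ j′ → j Fin.< j′ × Vertex M (i , j′)) →
    length (children M (i , j)) ≢ 2
  ¬right⇒¬two-children {i} {j} none = go (children M (i , j)) (children-unique (i , j)) ∈-children⁻
    where
    above : ∀ {p} → Parent M (i , j) p → NearestAbove M (i , j) p
    above (_ , _ , inj₁ a) = a
    above {_ , j′} (v , _ , inj₂ (_ , refl , j<j′ , _)) = contradiction (j′ , j<j′ , v) none

    go : ∀ ps → Unique ps → (∀ {p} → p ∈ ps → Parent M (i , j) p) → length ps ≢ 2
    go (p ∷ p′ ∷ []) ((p≢p′ ∷ []) ∷ _) parent _ = p≢p′ (nearestAbove-unique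
      (above x) (above x′) (proj₁ x) (proj₁ x′))
      where
      x  = parent (here refl)
      x′ = parent (there (here refl))

module _ {N} {M : Matrix (suc N)} (U : IsUpperDiagonalCNM M) where
  open IsUpperDiagonalCNM U
  open IsCNM isCNM
  private
    -- Going right in the row increases the sum, so the last vertex decides. It cannot have two
    -- children, so it is a leaf and lies on the antidiagonal.
    within′ : ∀ i j → Vertex M (i , j) → Acc Fin._>_ j → toℕ i + toℕ j ≤ N
    within′ i j v (acc rs) with any? (λ j′ → (j <ᶠ? j′) ×-dec vertex? M (i , j′))
    ... | yes (j′ , j<j′ , v′) =
      ≤-trans (+-monoʳ-≤ (toℕ i) (<⇒≤ j<j′)) (within′ i j′ v′ (rs j<j′))
    ... | no none with complete (i , j) v
    ...   | inj₁ e = ≤-reflexive (idx-sum⇒diagonal {i = i} {j} (leaf⇒diagonal i j (v , e)))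
    ...   | inj₂ e = contradiction e (¬right⇒¬two-children M none)

    index : ∀ {k} → k ≤ N → ∃ λ (i : Fin (suc N)) → toℕ i ≡ k
    index k≤N = fromℕ< (s≤s k≤N) , toℕ-fromℕ< _

    boundary′ : ∀ {i j} → i + j ≡ N → Dot (toGrid M) i j
    boundary′ {i} {j} e with index (m+n≤o⇒m≤o i (≤-reflexive e)) | index (m+n≤o⇒n≤o i (≤-reflexive e))
    ... | k , refl | l , refl = vertex⇒dot M (proj₁ (diagonal⇒leaf k l (diagonal⇒idx-sum {i = k} {l} e)))

  upperDiagonal⇒Staircase : Staircase N (toGrid M)
  upperDiagonal⇒Staircase = record
    { within    = λ v → case-within v
    ; boundary  = boundary′
    ; exclusive = exclusive′
    ; supported = supported′
    }
    where
    case-within : ∀ {i j} → Dot (toGrid M) i j → i + j ≤ N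
    case-within v with k , l , refl , refl ← dot-position M v =
      within′ k l (dot⇒vertex M v) (>-wellFounded l)

    exclusive′ : ∀ {i j} → Dot (toGrid M) i j → Above (toGrid M) i j → ¬ Left (toGrid M) i j
    exclusive′ v a l with i , j , refl , refl ← dot-position M v
      with aboveOrLeft (i , j) (dot⇒vertex M v)
             -- A vertex with another to its left is not in the first column, hence not the root.
             (λ (_ , e) → n≮0 (subst (_ <_) (suc-injective e) (proj₁ (proj₂ l))))
    ... | inj₁ (_ , ¬l) = ¬l (left⇒hasLeft M l)
    ... | inj₂ (¬a , _) = ¬a (above⇒hasAbove M a)

    supported′ : ∀ {i j} → Dot (toGrid M) i j → ¬ (i ≡ 0 × j ≡ 0) →
      Above (toGrid M) i j ⊎ Left (toGrid M) i j
    supported′ v r with i , j , refl , refl ← dot-position M v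
      with aboveOrLeft (i , j) (dot⇒vertex M v) (λ (e , e′) → r (suc-injective e , suc-injective e′))
    ... | inj₁ (a , _) = inj₁ (hasAbove⇒above M a)
    ... | inj₂ (_ , l) = inj₂ (hasLeft⇒left M l)

module _ {N} {M : Matrix (suc N)} (G : Staircase N (toGrid M)) where
  open Staircase G
  private
    -- Nothing lies above the first row, so supports lead left from its leaf to the root.
    origin : ∀ j → Dot (toGrid M) 0 j → Acc _<_ j → Dot (toGrid M) 0 0
    origin zero    v _ = v
    origin (suc j) v (acc rs) with supported v (λ { (_ , ()) })
    ... | inj₂ (j′ , p , u) = origin j′ u (rs p)

    leafColumn : ∀ i → ∃ λ j → toℕ i + toℕ j ≡ N
    leafColumn i = opposite i ,
      trans (cong (λ x → toℕ i + x) (opposite-prop i)) (m+[n∸m]≡n (s≤s⁻¹ (toℕ<n i)))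

    leafRow : ∀ j → ∃ λ i → toℕ i + toℕ j ≡ N
    leafRow j = let i , e = leafColumn j in i , trans (+-comm (toℕ i) (toℕ j)) e

    diagonal-vertex : ∀ {i j} → toℕ i + toℕ j ≡ N → Vertex M (i , j)
    diagonal-vertex e = dot⇒vertex M (boundary e)

    no-children : ∀ {i j} → toℕ i + toℕ j ≡ N → length (children M (i , j)) ≡ 0
    no-children {i} {j} e = go (children M (i , j)) (∈-children⁻ M)
      where
      ¬parent : ∀ {p} → ¬ Parent M (i , j) p
      ¬parent (v , _ , inj₁ (refl , i<i′ , _)) =
        <⇒≱ (+-monoˡ-< (toℕ j) i<i′) (≤-trans (within (vertex⇒dot M v)) (≤-reflexive (sym e)))
      ¬parent (v , _ , inj₂ (_ , refl , j<j′ , _)) =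
        <⇒≱ (+-monoʳ-< (toℕ i) j<j′) (≤-trans (within (vertex⇒dot M v)) (≤-reflexive (sym e)))

      go : ∀ ps → (∀ {p} → p ∈ ps → Parent M (i , j) p) → length ps ≡ 0
      go []      _      = refl
      go (p ∷ _) parent = contradiction (parent (here refl)) ¬parent

    -- The leaves of row `i` and column `j` lie strictly to the right and strictly below. The
    -- nearest vertices in these two directions are children, and uniqueness excludes any other.
    two-children : ∀ {i j} → Vertex M (i , j) → toℕ i + toℕ j ≢ N → length (children M (i , j)) ≡ 2
    two-children {i} {j} v e≢ = ≤-antisym
      (length-injection id (children-unique M (i , j)) only λ _ _ → id)
      (length-injection id ((d≢r ∷ []) ∷ [] ∷ []) both λ _ _ → id)
      where
      i+j<N : toℕ i + toℕ j < N
      i+j<N = ≤∧≢⇒< (within (vertex⇒dot M v)) e≢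

      right : ∃ λ j′ → j Fin.< j′ × Vertex M (i , j′)
      right = let j′ , e = leafColumn i in
        j′ , +-cancelˡ-< (toℕ i) _ _ (<-≤-trans i+j<N (≤-reflexive (sym e))) , diagonal-vertex e

      below : ∃ λ i′ → i Fin.< i′ × Vertex M (i′ , j)
      below = let i′ , e = leafRow j in
        i′ , +-cancelʳ-< (toℕ j) _ _ (<-≤-trans i+j<N (≤-reflexive (sym e))) , diagonal-vertex e

      leastRight = least (λ j′ → (j <ᶠ? j′) ×-dec vertex? M (i , j′)) right
      leastBelow = least (λ i′ → (i <ᶠ? i′) ×-dec vertex? M (i′ , j)) below

      d r : Position (suc N)
      d = proj₁ leastBelow , j
      r = i , proj₁ leastRight

      d≢r : d ≢ r
      d≢r e = <⇒≢ (proj₁ (proj₁ (proj₂ leastBelow))) (cong (toℕ ∘ proj₁) (sym e))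

      below-d : NearestAbove M (i , j) d
      below-d = let i′ , (i<i′ , _) , min = leastBelow in
        refl , i<i′ , v , λ k k<i′ w → ≮⇒≥ λ i<k → min k k<i′ (i<k , w)

      right-r : NearestLeft M (i , j) r
      right-r = let j′ , (j<j′ , _) , min = leastRight in
        refl , j<j′ , v , λ k k<j′ w → ≮⇒≥ λ j<k → min k k<j′ (j<k , w)

      vertex-d : Vertex M d
      vertex-d = proj₂ (proj₁ (proj₂ leastBelow))

      vertex-r : Vertex M r
      vertex-r = proj₂ (proj₁ (proj₂ leastRight))

      both : ∀ {p} → p ∈ d ∷ r ∷ [] → p ∈ children M (i , j)
      both (here refl) = ∈-children⁺ M (vertex-d ,
        (λ (e , _) → n≮0 (subst (_ <_) (suc-injective e) (proj₁ (proj₁ (proj₂ leastBelow))))) ,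
        inj₁ below-d)
      both (there (here refl)) = ∈-children⁺ M (vertex-r ,
        (λ (_ , e) → n≮0 (subst (_ <_) (suc-injective e) (proj₁ (proj₁ (proj₂ leastRight))))) ,
        -- The vertex `(i , j)` is left of `r`, so nothing is above `r` and its parent is found in
        -- its row.
        inj₂ ((λ a → exclusive (vertex⇒dot M vertex-r) (hasAbove⇒above M a)
          (toℕ j , proj₁ (proj₁ (proj₂ leastRight)) , vertex⇒dot M v)) , right-r))

      only : ∀ {p} → p ∈ children M (i , j) → p ∈ d ∷ r ∷ []
      only p∈ with ∈-children⁻ M p∈
      ... | w , _ , inj₁ a       = here (nearestAbove-unique M a below-d w vertex-d)
      ... | w , _ , inj₂ (_ , l) = there (here (nearestLeft-unique M l right-r w vertex-r))

    complete′ : ∀ p → Vertex M p → length (children M p) ≡ 0 ⊎ length (children M p) ≡ 2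
    complete′ (i , j) v with toℕ i + toℕ j ≟ N
    ... | yes e = inj₁ (no-children e)
    ... | no ¬e = inj₂ (two-children v ¬e)

    aboveOrLeft′ : ∀ p → Vertex M p → ¬ IsRoot p → ExactlyOne (HasAbove M p) (HasLeft M p)
    aboveOrLeft′ (i , j) v r
      with supported (vertex⇒dot M v) (λ (e , e′) → r (cong suc e , cong suc e′))
    ... | inj₁ a = inj₁ (above⇒hasAbove M a , λ l → exclusive (vertex⇒dot M v) a (hasLeft⇒left M l))
    ... | inj₂ l = inj₂ ((λ a → exclusive (vertex⇒dot M v) (hasAbove⇒above M a) l) , left⇒hasLeft M l)

    leaf⇒diagonal′ : ∀ i j → Leaf M (i , j) → idx i + idx j ≡ suc N + 1
    leaf⇒diagonal′ i j (v , e) with toℕ i + toℕ j ≟ N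
    ... | yes e′ = diagonal⇒idx-sum {i = i} {j} e′
    ... | no ¬e  = contradiction (trans (sym e) (two-children v ¬e)) λ ()

  Staircase⇒upperDiagonal : IsUpperDiagonalCNM M
  Staircase⇒upperDiagonal = record
    { isCNM = record
      { root        = (Fin.zero , Fin.zero) , (refl , refl) ,
                      dot⇒vertex M (origin N (boundary refl) (<-wellFounded N))
      ; aboveOrLeft = aboveOrLeft′
      ; rows        = λ i → let j , e = leafColumn i in j , diagonal-vertex e
      ; columns     = λ j → let i , e = leafRow j in i , diagonal-vertex e
      ; complete    = complete′
      }
    ; leaf⇒diagonal = leaf⇒diagonal′
    ; diagonal⇒leaf = λ i j e →
        diagonal-vertex (idx-sum⇒diagonal {i = i} {j} e) , no-children (idx-sum⇒diagonal {i = i} {j} e)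
    }

-- Counting staircase grids

-- `respects` is required because a grid and the grid of its truncated matrix agree only pointwise.
record Property : Set₁ where
  field
    Holds  : Grid → Set
    holds? : ∀ g → Dec (Holds g)
    respects   : ∀ {g h} → g ≐ h → Holds g → Holds h

open Property

staircase? : ∀ {N} (M : Matrix (suc N)) → Dec (Staircase N (toGrid M))
staircase? M = map′ upperDiagonal⇒Staircase Staircase⇒upperDiagonal (isUpperDiagonalCNM? M)

card : ℕ → Property → ℕ
card N P = length (filter (λ M → staircase? M ×-dec holds? P (toGrid M)) (allMatrices (suc N)))

≐-sym : ∀ {g h} → g ≐ h → h ≐ g
≐-sym e i j = sym (e i j)

≐-trans : ∀ {g h k} → g ≐ h → h ≐ k → g ≐ k
≐-trans e e′ i j = trans (e i j) (e′ i j)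

-- A map of grids acts on matrices through `toGrid` and `fromGrid`; bijections below are given as a
-- pair of opposite injections.
card-injection : ∀ {N N′} (P Q : Property) (φ : Grid → Grid) →
  (∀ {g} → Staircase N g → Holds P g → Staircase N′ (φ g) × Holds Q (φ g)) →
  (∀ {g h} → Staircase N g → Holds P g → Staircase N h → Holds P h → φ g ≐ φ h → g ≐ h) →
  card N P ≤ card N′ Q
card-injection {N} {N′} P Q φ into inj =
  length-injection φ′ (Unique.filter⁺ P? (allMatrices-unique (suc N)))
    (λ M∈ → let G , p = good M∈ ; G′ , q = into G p ; e = ≐-sym (toGrid-fromGrid G′) in
      ∈-filter⁺ Q? (allMatrices-complete _) (Staircase-resp e G′ , respects Q e q))
    (λ {M} {M′} M∈ M′∈ eq → let G , p = good M∈ ; G′ , p′ = good M′∈ in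
      toGrid-injective (inj G p G′ p′ (≐-trans (≐-sym (toGrid-fromGrid (proj₁ (into G p))))
        (subst (λ X → toGrid X ≐ φ (toGrid M′)) (sym eq) (toGrid-fromGrid (proj₁ (into G′ p′)))))))
  where
  φ′ : Matrix (suc N) → Matrix (suc N′)
  φ′ M = fromGrid (φ (toGrid M))

  P? : ∀ M → Dec (Staircase N (toGrid M) × Holds P (toGrid M))
  P? M = staircase? M ×-dec holds? P (toGrid M)

  Q? : ∀ M → Dec (Staircase N′ (toGrid M) × Holds Q (toGrid M))
  Q? M = staircase? M ×-dec holds? Q (toGrid M)

  good : ∀ {M} → M ∈ filter P? (allMatrices (suc N)) → Staircase N (toGrid M) × Holds P (toGrid M)
  good M∈ = proj₂ (∈-filter⁻ P? {xs = allMatrices (suc N)} M∈)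

card-cong : ∀ N (P Q : Property) →
  (∀ {g} → Staircase N g → Holds P g → Holds Q g) →
  (∀ {g} → Staircase N g → Holds Q g → Holds P g) → card N P ≡ card N Q
card-cong N P Q to from = ≤-antisym
  (card-injection P Q id (λ G p → G , to G p) λ _ _ _ _ e → e)
  (card-injection Q P id (λ G q → G , from G q) λ _ _ _ _ e → e)

everything : Property
everything = record { Holds = λ _ → ⊤ ; holds? = λ _ → yes tt ; respects = λ _ _ → tt }

infixr 6 _∧_
_∧_ : Property → Property → Property
P ∧ Q = record
  { Holds  = λ g → Holds P g × Holds Q g
  ; holds? = λ g → holds? P g ×-dec holds? Q g
  ; respects   = λ e (p , q) → respects P e p , respects Q e q
  }

not : Property → Property
not P = record
  { Holds  = λ g → ¬ Holds P g
  ; holds? = λ g → ¬? (holds? P g)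
  ; respects   = λ e ¬p p → ¬p (respects P (≐-sym e) p)
  }

dotAt leftOf : ℕ → ℕ → Property
dotAt a b = record
  { Holds  = λ g → Dot g a b
  ; holds? = λ g → g a b ≟ᵇ true
  ; respects   = λ e v → trans (sym (e a b)) v
  }
leftOf a b = record
  { Holds  = λ g → Left g a b
  ; holds? = λ g → anyUpTo? (λ j → g a j ≟ᵇ true) b
  ; respects   = λ e (j , j<b , v) → j , j<b , trans (sym (e a j)) v
  }

-- The bound on j is redundant; it makes the condition decidable.
emptyCorners : ℕ → ℕ → Property
emptyCorners k N = record
  { Holds  = λ g → ∀ {i} → i < k → ∀ {j} → j < N → suc (i + j) ≡ N → ¬ Dot g i j
  ; holds? = λ g → allUpTo? (λ i → allUpTo? (λ j → (suc (i + j) ≟ N) →-dec ¬? (g i j ≟ᵇ true)) N) k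
  ; respects   = λ e z p q s v → z p q s (trans (e _ _) v)
  }

card-split : ∀ N (P Q : Property) → card N P ≡ card N (P ∧ Q) + card N (P ∧ not Q)
card-split N P Q = length-filter-split (dec P) (dec (P ∧ Q)) (dec (P ∧ not Q)) (λ {M} → split {M})
  (λ (G , p , _) → G , p) (λ (G , p , _) → G , p) (λ (_ , _ , q) (_ , _ , ¬q) → ¬q q)
  (allMatrices (suc N))
  where
  dec : ∀ R M → Dec (Staircase N (toGrid M) × Holds R (toGrid M))
  dec R M = staircase? M ×-dec holds? R (toGrid M)

  split : ∀ {M} → Staircase N (toGrid M) × Holds P (toGrid M) →
    (Staircase N (toGrid M) × Holds (P ∧ Q) (toGrid M)) ⊎
    (Staircase N (toGrid M) × Holds (P ∧ not Q) (toGrid M))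
  split {M} (G , p) with holds? Q (toGrid M)
  ... | yes q = inj₁ (G , p , q)
  ... | no ¬q = inj₂ (G , p , ¬q)

card-empty : ∀ N (P : Property) → (∀ {g} → ¬ Holds P g) → card N P ≡ 0
card-empty N P ¬p = cong length (filter-none
  (λ M → staircase? M ×-dec holds? P (toGrid M))
  (All.universal (λ _ (_ , p) → ¬p p) (allMatrices (suc N))))

-- Corner and swap bijections, and the factorial count

card-corner : ∀ a b (P Q : Property) →
  (∀ {g} → Holds P g → Holds Q (contract a b g)) →
  (∀ {g} → Holds Q g → Holds P (expand a b g)) →
  card (suc (a + b)) (P ∧ dotAt a b) ≡ card (a + b) Q
card-corner a b P Q to from = ≤-antisym
  (card-injection (P ∧ dotAt a b) Q (contract a b) (λ G (p , v) → contract-Staircase G v , to p)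
    λ G (_ , v) H (_ , w) → contract-injective {a} {b} G v H w)
  (card-injection Q (P ∧ dotAt a b) (expand a b)
    (λ G q → expand-Staircase {a} {b} G , from q , expand-corner {a} {b} G)
    λ _ _ _ _ → expand-injective {a} {b})

-- The swap acts in both directions. On the right-hand side, row `a` starts at its leaf in column
-- `suc b`, so the corner is already empty.
card-swap : ∀ a b →
  card (suc (a + b)) ((leftOf a (suc b) ∧ not (leftOf (suc a) b)) ∧ not (dotAt a b)) ≡
  card (suc (a + b)) (leftOf (suc a) b ∧ not (leftOf a (suc b)))
card-swap a b = ≤-antisym
  (card-injection DE ED (swap a b)
    (λ G ((l , ¬l) , ¬c) → swap-Staircase {a} {b} G (left-¬left⇒swappable {a} {b} G l ¬l ¬c) ,
      swap-left {a} {b} G l ¬l ¬c , swap-¬left {a} {b} G l ¬l ¬c)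
    λ _ _ _ _ → swap-injective {a} {b})
  (card-injection ED DE (swap a b)
    (λ G (l , ¬l) → swap-Staircase {a} {b} G (¬left-left⇒swappable {a} {b} G ¬l l) ,
      (swap-left′ {a} {b} G ¬l l , swap-¬left′ {a} {b} G ¬l l) , swap-¬corner {a} {b} G ¬l l)
    λ _ _ _ _ → swap-injective {a} {b})
  where
  DE ED : Property
  DE = (leftOf a (suc b) ∧ not (leftOf (suc a) b)) ∧ not (dotAt a b)
  ED = leftOf (suc a) b ∧ not (leftOf a (suc b))

-- Grids in which both leaves have a vertex to their left cancel. The remaining ones match under the
-- swap, apart from those with a corner, which contract.
card-leftOf-step : ∀ a b → card (suc (a + b)) (leftOf a (suc b)) ≡
  card (suc (a + b)) (leftOf (suc a) b) + card (a + b) everything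
card-leftOf-step a b = begin
  # D                                            ≡⟨ card-split N D D′ ⟩
  # (D ∧ D′) + # (D ∧ not D′)
    ≡⟨ cong (λ x → # (D ∧ D′) + x) (card-split N (D ∧ not D′) (dotAt a b)) ⟩
  # (D ∧ D′) + (# ((D ∧ not D′) ∧ dotAt a b) + # ((D ∧ not D′) ∧ not (dotAt a b)))
    ≡⟨ cong₂ _+_ (card-cong N (D ∧ D′) (D′ ∧ D) (λ _ (x , y) → y , x) (λ _ (x , y) → y , x))
         (trans (cong₂ _+_ corner (card-swap a b)) (+-comm U _)) ⟩
  # (D′ ∧ D) + (# (D′ ∧ not D) + U)              ≡⟨ +-assoc (# (D′ ∧ D)) _ U ⟨
  # (D′ ∧ D) + # (D′ ∧ not D) + U                ≡⟨ cong (_+ U) (card-split N D′ D) ⟨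
  # D′ + U                                       ∎
  where
  open ≡-Reasoning
  N U : ℕ
  N = suc (a + b)
  U = card (a + b) everything
  # : Property → ℕ
  # = card N
  D D′ : Property
  D  = leftOf a (suc b)
  D′ = leftOf (suc a) b
  corner : # ((D ∧ not D′) ∧ dotAt a b) ≡ U
  corner = trans
    (card-cong N ((D ∧ not D′) ∧ dotAt a b) (everything ∧ dotAt a b) (λ _ (_ , v) → tt , v)
      (λ G (_ , v) → (corner⇒left {a} {b} G v , corner⇒¬left {a} {b} G v) , v))
    (card-corner a b everything everything _ _)

-- The step is iterated along the antidiagonal down to the leaf in column 0, which has nothing to
-- its left.
card-leftOf : ∀ b a {N} → a + b ≡ N → card N (leftOf a b) ≡ b ℕ.* card (pred N) everything
card-leftOf zero    a {N} _ = card-empty N (leftOf a 0) λ ()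
-- Writing `N` as `suc (a + b)` lets `pred N` reduce.
card-leftOf (suc b) a     e = subst
  (λ N → card N (leftOf a (suc b)) ≡ suc b ℕ.* card (pred N) everything)
  (trans (sym (+-suc a b)) e)
  (begin
    card (suc (a + b)) (leftOf a (suc b))        ≡⟨ card-leftOf-step a b ⟩
    card (suc (a + b)) (leftOf (suc a) b) + U    ≡⟨ cong (_+ U) (card-leftOf b (suc a) refl) ⟩
    b ℕ.* U + U                                    ≡⟨ +-comm (b ℕ.* U) U ⟩
    suc b ℕ.* U                                    ∎)
  where
  open ≡-Reasoning
  U : ℕ
  U = card (a + b) everything

-- The leaf of the first row can only be supported from the left, so `leftOf 0 (suc m)` holds for
-- every staircase grid.
card-everything : ∀ m → card m everything ≡ m !
-- The two matrices of size 1 are checked by evaluation.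
card-everything zero    = refl
card-everything (suc m) = begin
  card (suc m) everything
    ≡⟨ card-cong (suc m) everything (leftOf 0 (suc m)) (λ G _ → firstLeaf G) _ ⟩
  card (suc m) (leftOf 0 (suc m))  ≡⟨ card-leftOf (suc m) 0 refl ⟩
  suc m ℕ.* card m everything        ≡⟨ cong (suc m ℕ.*_) (card-everything m) ⟩
  suc m !                          ∎
  where
  open ≡-Reasoning
  firstLeaf : ∀ {g} → Staircase (suc m) g → Left g 0 (suc m)
  firstLeaf G with Staircase.supported G (Staircase.boundary G refl) (λ { (_ , ()) })
  ... | inj₂ l = l

-- Empty corners and the recurrence for the first corner

emptyCorners-contract : ∀ {a b g} → Holds (emptyCorners a (suc (a + b))) g →
  Holds (emptyCorners (pred a) (a + b)) (contract a b g)
-- A cell in question lies right of column `b`, so it comes from the corner cell of the same row one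
-- column further. The last empty cell of the large grid lies in the deleted column, which explains
-- `pred`.
emptyCorners-contract {suc a} {b} {g} z {i} i<a {j} j<N e v = z (m<n⇒m<1+n i<a) (s≤s j<N)
  (cong suc (trans (+-suc i j) e))
  (subst₂ (Dot g) (punch-low (<⇒≤ (m<n⇒m<1+n i<a))) (punch-high b<j) v)
  where
  b<j : b < j
  b<j = ≰⇒> λ j≤b → <⇒≢ (+-mono-<-≤ i<a j≤b) (suc-injective e)

-- The cell of row `a - 1` falls in the inserted column, whose only vertex is in row `a`; the cells
-- of earlier rows are old cells.
emptyCorners-expand : ∀ {a b g} → Holds (emptyCorners (pred a) (a + b)) g →
  Holds (emptyCorners a (suc (a + b))) (expand a b g)
emptyCorners-expand {a} {b} {g} z {i} i<a {j} _ e v =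
  go (gap? a i) (gap? b j) i<a (suc-injective e) v
  where
  go : ∀ {i j} → Gap a i → Gap b j → i < a → i + j ≡ a + b → ¬ Dot (expand a b g) i j
  go gap      _   i<a _ _ = <-asym i<a ≤-refl
  go (past i) gap i<a _ v = <-irrefl (trans (cong (punch a) i≡a) (punch-fixes a)) i<a
    where
    i≡a : i ≡ a
    i≡a = ≡ᵇ-true⇒≡ (trans (sym (expand-column {a} {b} {g} i)) v)
  go (past i) (past j) i<a e v =
    z (<⇒≤pred (+-cancelʳ-≤ b (suc (suc i)) a bound)) j<N e′
      (trans (sym (expand-punch {a} {b} {g} i j)) v)
    where
    open ≤-Reasoning
    i<a′ : i < a
    i<a′ = ≤-<-trans (punch-increasing a i) i<a
    b<j : b < j
    b<j = ≰⇒> λ j≤b → <⇒≢ (+-mono-<-≤ i<a (≤-trans (≤-reflexive (punch-low j≤b)) j≤b)) e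
    e′ : suc (i + j) ≡ a + b
    e′ = trans (sym (+-suc i j))
      (trans (cong₂ _+_ (sym (punch-low (<⇒≤ i<a′))) (sym (punch-high b<j))) e)
    j<N : j < a + b
    j<N = subst (j <_) e′ (s≤s (m≤n+m j i))
    -- As `j` exceeds `b`, the equation `e′` leaves room for two more rows, so `i < pred a`.
    bound : suc (suc i) + b ≤ a + b
    bound = begin
      suc (suc i + b)  ≡⟨ +-suc (suc i) b ⟨
      suc i + suc b    ≤⟨ +-monoʳ-≤ (suc i) b<j ⟩
      suc i + j        ≡⟨ e′ ⟩
      a + b            ∎

-- This is `f (2 + a + b) a`, indexed by the position of the first corner to avoid subtraction.
firstCorner : ℕ → ℕ → ℕ
firstCorner a b = card (suc (a + b)) (emptyCorners a (suc (a + b)) ∧ dotAt a b)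

firstCorner-contract : ∀ a b → firstCorner a b ≡ card (a + b) (emptyCorners (pred a) (a + b))
firstCorner-contract a b = card-corner a b (emptyCorners a (suc (a + b))) (emptyCorners (pred a) (a + b))
  (emptyCorners-contract {a} {b}) (emptyCorners-expand {a} {b})

card-emptyCorners : ∀ a b → card (suc (a + b)) (emptyCorners a (suc (a + b))) ≡
  firstCorner a b + card (suc (a + b)) (emptyCorners (suc a) (suc (a + b)))
card-emptyCorners a b = trans (card-split N Z (dotAt a b))
  (cong (λ x → firstCorner a b + x) (card-cong N (Z ∧ not (dotAt a b)) (emptyCorners (suc a) N)
    (λ {g} _ → extend {g})
    (λ _ z → (λ p → z (m<n⇒m<1+n p)) , z ≤-refl (s≤s (m≤n+m b a)) refl)))
  where
  N : ℕ
  N = suc (a + b)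
  Z : Property
  Z = emptyCorners a N
  extend : ∀ {g} → Holds (Z ∧ not (dotAt a b)) g → Holds (emptyCorners (suc a) N) g
  extend (z , ¬v) {i} p {j} q e v with i ≟ a
  ... | no i≢a   = z (≤∧≢⇒< (s≤s⁻¹ p) i≢a) q e v
  ... | yes refl with refl ← +-cancelˡ-≡ a j b (suc-injective e) = ¬v v

card-emptyCorners-zero : ∀ N → card N (emptyCorners 0 N) ≡ N !
card-emptyCorners-zero N = trans
  (card-cong N (emptyCorners 0 N) everything (λ _ _ → tt) (λ _ _ ())) (card-everything N)

firstCorner-zero : ∀ b → firstCorner 0 b ≡ b !
firstCorner-zero b = trans (firstCorner-contract 0 b) (card-emptyCorners-zero b)

-- The single empty cell prescribed disappears on contraction.
firstCorner-one : ∀ b → firstCorner 1 b ≡ suc b !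
firstCorner-one b = trans (firstCorner-contract 1 b) (card-emptyCorners-zero (suc b))

-- `firstCorner (suc a) (suc b)` contracts to the grids with `a` empty corners. Those with a vertex
-- at the next one are counted by `firstCorner a (suc b)`; the others are the contractions counted
-- by `firstCorner (2 + a) b`.
firstCorner-step : ∀ a b →
  firstCorner (suc (suc a)) b + firstCorner a (suc b) ≡ firstCorner (suc a) (suc b)
firstCorner-step a b = begin
  firstCorner (2 + a) b + firstCorner a (suc b)
    ≡⟨ +-comm (firstCorner (2 + a) b) _ ⟩
  firstCorner a (suc b) + firstCorner (2 + a) b
    ≡⟨ cong (λ x → firstCorner a (suc b) + x) (firstCorner-contract (2 + a) b) ⟩
  firstCorner a (suc b) + Z (suc (suc (a + b)))
    ≡⟨ cong (λ N → firstCorner a (suc b) + Z (suc N)) (+-suc a b) ⟨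
  firstCorner a (suc b) + Z (suc (a + suc b))
    ≡⟨ card-emptyCorners a (suc b) ⟨
  card (suc (a + suc b)) (emptyCorners a (suc (a + suc b)))
    ≡⟨ firstCorner-contract (suc a) (suc b) ⟨
  firstCorner (suc a) (suc b) ∎
  where
  open ≡-Reasoning
  Z : ℕ → ℕ
  Z N = card N (emptyCorners (suc a) N)

-- With `n = suc N`, numbering from 0 turns `idx i + idx j ≡ n` into `suc (i + j) ≡ N`.
f≡firstCorner : ∀ a b → f (suc (suc (a + b))) a ≡ firstCorner a b
f≡firstCorner a b = cong length (filter-≐ (λ M → isUpperDiagonalCNM? M ×-dec firstOneAfter? M a)
  (λ M → staircase? M ×-dec holds? P (toGrid M)) (to , from) (allMatrices (suc N)))
  where
  N : ℕ
  N = suc (a + b)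
  P : Property
  P = emptyCorners a N ∧ dotAt a b

  to : ∀ {M} → IsUpperDiagonalCNM M × FirstOneAfter M a → Staircase N (toGrid M) × Holds P (toGrid M)
  to {M} (U , F) = upperDiagonal⇒Staircase U , empty , corner
    where
    open FirstOneAfter F
    empty : Holds (emptyCorners a N) (toGrid M)
    empty p _ e v with i , j , refl , refl ← dot-position M v =
      contradiction (trans (sym (dot⇒vertex M v))
        (zeros i j p (cong suc (trans (+-suc (toℕ i) (toℕ j)) e)))) λ ()
    corner : Dot (toGrid M) a b
    corner with i , j , e , e′ , v ← one = subst₂ (Dot (toGrid M)) i≡a j≡b (vertex⇒dot M v)
      where
      i≡a : toℕ i ≡ a
      i≡a = suc-injective (trans e (+-comm a 1))
      j≡b : toℕ j ≡ b
      j≡b = +-cancelˡ-≡ a (toℕ j) b (trans (cong (_+ toℕ j) (sym i≡a))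
        (suc-injective (trans (sym (+-suc (toℕ i) (toℕ j))) (suc-injective e′))))

  from : ∀ {M} → Staircase N (toGrid M) × Holds P (toGrid M) → IsUpperDiagonalCNM M × FirstOneAfter M a
  from {M} (G , z , c) = Staircase⇒upperDiagonal G , record
    { zeros = λ i j p e → let e′ = trans (sym (+-suc (toℕ i) (toℕ j))) (suc-injective e) in
        ¬-not λ v → z p (subst (toℕ j <_) e′ (s≤s (m≤n+m (toℕ j) (toℕ i)))) e′ (vertex⇒dot M v)
    ; one = corner
    }
    where
    corner : ∃ λ i → ∃ λ j → idx i ≡ a + 1 × idx i + idx j ≡ suc N × entry M (i , j) ≡ true
    corner with i , j , e , e′ ← dot-position M c = i , j ,
      trans (cong suc e) (+-comm 1 a) ,
      trans (cong₂ (λ x y → suc x + suc y) e e′) (cong suc (+-suc a b)) ,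
      dot⇒vertex M (subst₂ (Dot (toGrid M)) (sym e) (sym e′) c)

-- The alternating sum

term : ℕ → ℕ → ℕ → ℤ
term m k j = ℤ.+ ((k ∸ j) C j) * -1ℤ ^ j * ℤ.+ ((m ∸ j) !)

alternatingSum : ℕ → ℕ → ℤ
alternatingSum m k = ∑[ j ≤ k ] term m k (toℕ j)

alternatingSum-zero : ∀ m → alternatingSum m 0 ≡ ℤ.+ (m !)
alternatingSum-zero m = trans (ℤ.+-identityʳ _) (ℤ.*-identityˡ (+ (m !)))

-- The term `j = 1` vanishes with its coefficient `0 C 1`.
alternatingSum-one : ∀ m → alternatingSum m 1 ≡ ℤ.+ (m !)
alternatingSum-one m = trans (ℤ.+-identityʳ _) (ℤ.*-identityˡ (+ (m !)))

-- Pascal's rule splits the first coefficient; the part with `C j` has the opposite sign to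
-- `term m k j` and the same factorial, so the two cancel.
term-pascal : ∀ m {k j} → j ≤ k →
  term (suc m) (2 + k) (suc j) ℤ.+ term m k j ≡ term (suc m) (suc k) (suc j)
term-pascal m {k} {j} j≤k = begin
  ℤ.+ ((suc k ∸ j) C suc j) * (-1ℤ * s) * w ℤ.+ ℤ.+ (c C j) * s * w
    ≡⟨ cong (λ n → ℤ.+ (n C suc j) * (-1ℤ * s) * w ℤ.+ ℤ.+ (c C j) * s * w) (+-∸-assoc 1 j≤k) ⟩
  ℤ.+ (suc c C suc j) * (-1ℤ * s) * w ℤ.+ ℤ.+ (c C j) * s * w
    ≡⟨ cong (λ n → ℤ.+ n * (-1ℤ * s) * w ℤ.+ ℤ.+ (c C j) * s * w) (nCk+nC[k+1]≡[n+1]C[k+1] c j) ⟨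
  ℤ.+ (c C j + c C suc j) * (-1ℤ * s) * w ℤ.+ ℤ.+ (c C j) * s * w
    ≡⟨ cong (λ x → x * (-1ℤ * s) * w ℤ.+ ℤ.+ (c C j) * s * w) (ℤ.pos-+ (c C j) (c C suc j)) ⟩
  (+ (c C j) ℤ.+ ℤ.+ (c C suc j)) * (-1ℤ * s) * w ℤ.+ ℤ.+ (c C j) * s * w
    ≡⟨ cancel (+ (c C j)) (+ (c C suc j)) s w ⟩
  ℤ.+ (c C suc j) * (-1ℤ * s) * w ∎
  where
  open ≡-Reasoning
  c : ℕ
  c = k ∸ j
  s w : ℤ
  s = -1ℤ ^ j
  w = ℤ.+ ((m ∸ j) !)
  cancel : ∀ x y s w → (x ℤ.+ y) * (-1ℤ * s) * w ℤ.+ x * s * w ≡ y * (-1ℤ * s) * w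
  cancel = solve-∀

-- The terms for `j = 0` agree, and term `suc j` of the longer sum is paired with term `j` of the
-- shorter one.
alternatingSum-step : ∀ m k →
  alternatingSum (suc m) (2 + k) ℤ.+ alternatingSum m k ≡ alternatingSum (suc m) (suc k)
alternatingSum-step m k = begin
  t₀ ℤ.+ (∑[ j ≤ suc k ] X (toℕ j)) ℤ.+ Z
    ≡⟨ cong (λ x → t₀ ℤ.+ x ℤ.+ Z) (sum-init-last {suc k} (λ j → X (toℕ j))) ⟩
  t₀ ℤ.+ ((∑[ j ≤ k ] X (toℕ (inject₁ j))) ℤ.+ X (toℕ (fromℕ (suc k)))) ℤ.+ Z
    ≡⟨ cong (λ x → t₀ ℤ.+ x ℤ.+ Z) (cong₂ ℤ._+_
         (sum-cong-≗ {suc k} (λ j → cong X (toℕ-inject₁ j)))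
         (trans (cong X (toℕ-fromℕ (suc k))) X-last)) ⟩
  t₀ ℤ.+ ((∑[ j ≤ k ] X (toℕ j)) ℤ.+ + 0) ℤ.+ Z
    ≡⟨ cong (λ x → t₀ ℤ.+ x ℤ.+ Z) (ℤ.+-identityʳ (∑[ j ≤ k ] X (toℕ j))) ⟩
  t₀ ℤ.+ (∑[ j ≤ k ] X (toℕ j)) ℤ.+ Z
    ≡⟨ ℤ.+-assoc t₀ (∑[ j ≤ k ] X (toℕ j)) Z ⟩
  t₀ ℤ.+ ((∑[ j ≤ k ] X (toℕ j)) ℤ.+ Z)
    ≡⟨ cong (λ x → t₀ ℤ.+ x) (∑-distrib-+ {suc k} (λ j → X (toℕ j)) (λ j → term m k (toℕ j))) ⟨
  t₀ ℤ.+ (∑[ j ≤ k ] (X (toℕ j) ℤ.+ term m k (toℕ j)))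
    ≡⟨ cong (λ x → t₀ ℤ.+ x) (sum-cong-≗ {suc k} (λ j → term-pascal m (s≤s⁻¹ (toℕ<n j)))) ⟩
  alternatingSum (suc m) (suc k) ∎
  where
  open ≡-Reasoning
  t₀ Z : ℤ
  t₀ = term (suc m) (2 + k) 0
  Z = alternatingSum m k
  X : ℕ → ℤ
  X j = term (suc m) (2 + k) (suc j)
  -- The unpaired last term has coefficient `0 C (2 + k)`.
  X-last : X (suc k) ≡ ℤ.+ 0
  X-last = cong (λ n → ℤ.+ (n C (2 + k)) * -1ℤ ^ (2 + k) * ℤ.+ ((m ∸ suc k) !)) (n∸n≡0 k)

-- Both sides satisfy the same recurrence, two steps deep in `a`; `b` stays general because the
-- earlier values occur at `suc b`.
firstCorner-formula : ∀ a b → + firstCorner a b ≡ alternatingSum (a + b) a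
firstCorner-formula zero b =
  trans (cong (+_) (firstCorner-zero b)) (sym (alternatingSum-zero b))
firstCorner-formula (suc zero) b =
  trans (cong (+_) (firstCorner-one b)) (sym (alternatingSum-one (suc b)))
firstCorner-formula (suc (suc a)) b = trans (+-cancelʳ-≡ᶻ (begin
  + firstCorner (2 + a) b ℤ.+ alternatingSum m a
    ≡⟨ cong (λ x → + firstCorner (2 + a) b ℤ.+ x) (firstCorner-formula a (suc b)) ⟨
  + firstCorner (2 + a) b ℤ.+ + firstCorner a (suc b)
    ≡⟨ ℤ.pos-+ (firstCorner (2 + a) b) (firstCorner a (suc b)) ⟨
  + (firstCorner (2 + a) b + firstCorner a (suc b))
    ≡⟨ cong (+_) (firstCorner-step a b) ⟩
  + firstCorner (suc a) (suc b)
    ≡⟨ firstCorner-formula (suc a) (suc b) ⟩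
  alternatingSum (suc m) (suc a)
    ≡⟨ alternatingSum-step m a ⟨
  alternatingSum (suc m) (2 + a) ℤ.+ alternatingSum m a ∎))
  (cong (λ x → alternatingSum (suc x) (2 + a)) (+-suc a b))
  where
  open ≡-Reasoning
  m : ℕ
  m = a + suc b
  +-cancelʳ-≡ᶻ : ∀ {x y z} → x ℤ.+ z ≡ y ℤ.+ z → x ≡ y
  +-cancelʳ-≡ᶻ {x} {y} {z} = ∙-cancelʳ z x y

f-formula : ∀ {m} k b → k + b ≡ m → + f (2 + m) k ≡ alternatingSum m k
f-formula k b refl = trans (cong (+_) (f≡firstCorner k b)) (firstCorner-formula k b)

theorem4p10 : ∀ (n k : ℕ) → 2 ≤ n → k ≤ n ∸ 2 →
    + f n k ≡ ∑[ j ≤ k ] (+ ((k ∸ toℕ j) C toℕ j) * -1ℤ ^ toℕ j * + ((n ∸ 2 ∸ toℕ j) !))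
-- Counted from 0, the corner in row `k` lies in column `m ∸ k`.
theorem4p10 (suc (suc m)) k (s≤s (s≤s z≤n)) k≤m = f-formula k (m ∸ k) (m+[n∸m]≡n k≤m)
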